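{- Let $n=2^s$, $q=2^r$ ($s,r$ positive integers), $N=|SL(n,q)|$, and let $\{C_i\}_{i=0}^N$ be the weight distribution of the binary code $C=C(SL(n,q))$. Then for $0\le i\le N$, $$C_i=\sum\prod_{\beta\in\mathbb{F}_q}\binom{n_\beta}{\nu_\beta},$$ where $n_\beta=q^{\binom{n}{2}-1}\{\prod_{j=2}^n(q^j-1)+1+q\theta(\beta)\}$ with $\theta(\beta)=K_{n-2}(\lambda;\beta^{ -1})$ for $\beta\ne0$ and $\theta(0)=0$, and the sum runs over all families of nonnegative integers $\{\nu_\beta\}_{\beta\in\mathbb{F}_q}$ with $\sum_\beta\nu_\beta=i$ and $\sum_\beta\nu_\beta\beta=0$ (an identity in $\mathbb{F}_q$).
   Context: $Tr$ is the matrix trace; fix an ordering $g_1,\dots,g_N$ of $SL(n,q)$, let $v=(Tr(g_1),\dots,Tr(g_N))\in\mathbb{F}_q^N$ and $C(SL(n,q))=\{u\in\mathbb{F}_2^N:u\cdot v=0\}$ (dot product in $\mathbb{F}_q$); $C_i$ is the number of codewords of Hamming weight $i$. $tr$ is the absolute trace $\mathbb{F}_q\to\mathbb{F}_2$, $\lambda(x)=(-1)^{tr(x)}$, $K_m(\lambda;a)=\sum_{\alpha_1,\dots,\alpha_m\in\mathbb{F}_q^*}\lambda(\alpha_1+\cdots+\alpha_m+a\alpha_1^{ -1}\cdots\alpha_m^{ -1})$ for $m\ge1$, and $K_0(\lambda;a)=\lambda(a)$. Convention $\binom{b}{a}=0$ if $b<a$. -}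

module Defs where

open import Level using (0ℓ)
open import Data.Nat as ℕ using (ℕ; zero; suc; _^_; _≤_)
open import Data.Nat.Combinatorics using (_C_)
open import Data.Integer as ℤ using (ℤ; +_; -[1+_])
open import Data.Fin as Fin using (Fin; toℕ)
open import Data.Fin.Properties using () renaming (_≟_ to _≟F_)
open import Data.Vec as Vec using (Vec; []; _∷_; removeAt; lookup)
open import Data.List as List using (List; []; _∷_; _++_; concatMap; filter; length; allFin; upTo)
open import Data.Bool using (Bool; true; false; if_then_else_)
open import Relation.Nullary using (¬_; Dec; yes; no; does)
open import Relation.Binary.PropositionalEquality using (_≡_)
import Algebra.Structures as AS

-- A finite field structure on the carrier Fin q (elements enumerated),
-- with propositional equality.  The inverse is a total function whose
-- value at 0 is irrelevant; it is only required to invert nonzero elements.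

record FiniteField (q : ℕ) : Set where
  field
    _+_ _*_ : Fin q → Fin q → Fin q
    -_ : Fin q → Fin q
    0# 1# : Fin q
    isCommutativeRing : AS.IsCommutativeRing {A = Fin q} _≡_ _+_ _*_ -_ 0# 1#
    0≢1 : ¬ (0# ≡ 1#)
    _⁻¹ : Fin q → Fin q
    inverseʳ : ∀ x → ¬ (x ≡ 0#) → (x * (x ⁻¹)) ≡ 1#

module FieldDefs {q : ℕ} (F : FiniteField q) where
  open FiniteField F

  Elt : Set
  Elt = Fin q

  elements : List Elt
  elements = allFin q

  nonzero : List Elt
  nonzero = filter (λ x → Relation.Nullary.¬? (x ≟F 0#)) elements
    where import Relation.Nullary

  sumF : List Elt → Elt
  sumF = List.foldr _+_ 0#

  pow : Elt → ℕ → Elt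
  pow x zero    = 1#
  pow x (suc k) = x * pow x k

  smul : ℕ → Elt → Elt
  smul zero    x = 0#
  smul (suc k) x = x + smul k x

  -- absolute trace F_{2^r} → F_2 ⊆ F_q :  tr(x) = Σ_{k<r} x^(2^k)
  absTr : (r : ℕ) → Elt → Elt
  absTr r x = sumF (List.map (λ k → pow x (2 ^ k)) (upTo r))

  addChar : (r : ℕ) → Elt → ℤ
  addChar r x = if does (absTr r x ≟F 0#) then + 1 else -[1+ 0 ]

  sumN : List ℕ → ℕ
  sumN = List.foldr ℕ._+_ 0

  sumℤ : List ℤ → ℤ
  sumℤ = List.foldr ℤ._+_ (+ 0)

  -- Kloosterman-type sum helper:
  --   aux m s p = Σ_{α₁..α_m ∈ F*} λ(s + α₁+…+α_m + a (p α₁⋯α_m)⁻¹)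
  klAux : (r : ℕ) → Elt → ℕ → Elt → Elt → ℤ
  klAux r a zero    s p = addChar r (s + (a * (p ⁻¹)))
  klAux r a (suc m) s p = sumℤ (List.map (λ α → klAux r a m (s + α) (p * α)) nonzero)

  -- K_m(λ; a) = Σ_{α₁..α_m ∈ F*} λ(α₁+⋯+α_m + a α₁⁻¹⋯α_m⁻¹);  K_0(λ;a) = λ(a)
  -- (uses (α₁⋯α_m)⁻¹ = α₁⁻¹⋯α_m⁻¹, and 1⁻¹ = 1 for m = 0)
  K : (r : ℕ) → ℕ → Elt → ℤ
  K r m a = klAux r a m 0# 1#

  θ : (r n : ℕ) → Elt → ℤ
  θ r n β = if does (β ≟F 0#) then + 0 else K r (n ℕ.∸ 2) (β ⁻¹)

  Mat : ℕ → Set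
  Mat n = Vec (Vec Elt n) n

  sign : ℕ → Elt
  sign zero    = 1#
  sign (suc k) = - sign k

  det : (n : ℕ) → Mat n → Elt
  det zero    []           = 1#
  det (suc n) (row ∷ rows) =
    sumF (List.map (λ j → (sign (toℕ j) * lookup row j)
                           * det n (Vec.map (λ r → removeAt r j) rows))
                   (allFin (suc n)))

  matTrace : (n : ℕ) → Mat n → Elt
  matTrace n M = sumF (Vec.toList (Vec.map (λ i → lookup (lookup M i) i) (Vec.allFin n)))

  allVecs : {A : Set} → List A → (n : ℕ) → List (Vec A n)
  allVecs xs zero    = [] ∷ []
  allVecs xs (suc n) = concatMap (λ x → List.map (x ∷_) (allVecs xs n)) xs

  allMats : (n : ℕ) → List (Mat n)
  allMats n = allVecs (allVecs elements n) n

  SL : (n : ℕ) → List (Mat n)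
  SL n = filter (λ M → det n M ≟F 1#) (allMats n)

  traceVec : (n : ℕ) → List Elt
  traceVec n = List.map (matTrace n) (SL n)

  dot : List Bool → List Elt → Elt
  dot (true  ∷ us) (v ∷ vs) = v + dot us vs
  dot (false ∷ us) (v ∷ vs) = dot us vs
  dot _ _ = 0#

  weight : List Bool → ℕ
  weight = List.foldr (λ b k → if b then suc k else k) 0

  codeWeight : (n i : ℕ) → ℕ
  codeWeight n i =
    length (filter (λ u → weight (Vec.toList u) ℕ.≟ i)
           (filter (λ u → dot (Vec.toList u) (traceVec n) ≟F 0#)
                   (allVecs (true ∷ false ∷ []) (length (SL n)))))

  -- binomial coefficient with integer top, and C(b,a) = 0 when b < a
  binomℤ : ℤ → ℕ → ℤ
  binomℤ (+ b)      a = + (b C a)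
  binomℤ -[1+ b ]   a = + 0

  nβ : (r n : ℕ) → Elt → ℤ
  nβ r n β =
    + (q ^ ((n C 2) ℕ.∸ 1)) ℤ.*
      ( + (List.foldr ℕ._*_ 1 (List.map (λ j → q ^ (2 ℕ.+ j) ℕ.∸ 1) (upTo (n ℕ.∸ 1))))
        ℤ.+ + 1 ℤ.+ (+ q ℤ.* θ r n β))

  -- families {ν_β}_{β∈F_q} (as ν : Vec ℕ q indexed by β) with Σ ν_β = i and Σ ν_β β = 0.
  -- Each ν_β ≤ i, so enumerating entries in {0,…,i} is exhaustive.
  families : (i : ℕ) → List (Vec ℕ q)
  families i =
    filter (λ ν → sumF (List.map (λ β → smul (lookup ν β) β) elements) ≟F 0#)
      (filter (λ ν → sumN (Vec.toList ν) ℕ.≟ i)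
        (allVecs (upTo (suc i)) q))

  rhs : (r n i : ℕ) → ℤ
  rhs r n i =
    sumℤ (List.map (λ ν → List.foldr ℤ._*_ (+ 1)
                            (List.map (λ β → binomℤ (nβ r n β) (lookup ν β)) elements))
                   (families i))

{-# OPTIONS --safe #-}
module Submission where

-- Choosing a word amounts to choosing, for each β, ν_β of the coordinates whose trace
-- is β, so it suffices to show that n_β is the number of matrices of determinant 1 and
-- trace β.  By orthogonality of the characters x ↦ λ(ux) this number is determined by
-- |SL(n,q)| and by the sums of λ(u Tr M) over det M = 1 with u ≠ 0.
--
-- Write M = [[a, b], [c, D]].  If c ≠ 0, adding multiples of a lower row to the first
-- row keeps det M and equidistributes Tr M, so these M cancel; those with c = 0 give
-- G_n(d) = q^(n-1) Σ_a λ(a) G_(n-1)(d/a), whence G_n(d) = q^(n choose 2) K_(n-1)(λ; d).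
-- Rescaling replaces d = 1 by u^n, and since n is a power of 2 the Frobenius map gives
-- K_(n-1)(λ; u^n) = K_(n-1)(λ; u).  The Fourier transform of u ↦ K_(n-1)(λ; u) at β is
-- q K_(n-2)(λ; 1/β) + 1, which is the correction term in n_β.

open import Defs
open import Level using (0ℓ)
open import Algebra.Bundles using (CommutativeRing)
import Algebra.Properties.CommutativeMonoid.Sum
import Algebra.Properties.Group
import Algebra.Properties.Semiring.Sum
import Algebra.Solver.Ring.NaturalCoefficients.Default
open import Data.Bool using (Bool; true; false; if_then_else_)
open import Data.Empty using (⊥-elim)
open import Data.Fin as Fin using (Fin; zero; suc)
open import Data.Fin.Permutation using (permutation)
open import Data.Fin.Properties as Finₚ using () renaming (_≟_ to _≟F_)
open import Data.Integer as ℤ using (ℤ; -[1+_]) renaming (+_ to pos)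
import Data.Integer.Properties as ℤₚ
import Data.Integer.Tactic.RingSolver as ℤSolver
open import Data.List as List using (List; []; _∷_; _++_; concatMap; filter; length; allFin; upTo)
import Data.List.Properties as Listₚ
open import Data.Nat as ℕ using (ℕ; zero; suc; _^_; _≤_; _<_; z≤n; s≤s)
open import Data.Nat.Combinatorics using (_C_; nC1≡n; nCk+nC[k+1]≡[n+1]C[k+1])
open import Data.Nat.ListAction using (product)
open import Data.Nat.ListAction.Properties using (product-++)
import Data.Nat.Properties as ℕₚ
open import Data.Product using (∃; _×_; _,_; proj₁; proj₂)
open import Data.Unit using (⊤; tt)
open import Data.Vec as Vec using (Vec; []; _∷_; removeAt; lookup; zipWith; replicate)
import Data.Vec.Properties as Vecₚ
open import Function using (_∘_; id)
open import Relation.Binary.PropositionalEquality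
open import Relation.Nullary using (¬_; Dec; yes; no; does; ¬?)
open import Relation.Nullary.Decidable using (dec-true; dec-false)
open ≡-Reasoning

-- The field is given only as a ring structure with inverses on 2^r labels, so characteristic 2, x^q
-- = x and the nontriviality of λ have to be derived: the first two by permuting all elements inside
-- a sum or a product, the last because the trace is a monic polynomial function of degree 2^(r-1) <
-- q. Characteristic 2 removes the signs from the determinant, but it also empties the usual
-- argument that equal rows give det = -det and hence 0; that vanishing gets its own induction on
-- the columns. The summand 1 in n_β comes from the value u = 0, which the transform of u ↦
-- K_(n-1)(λ; u) leaves out: the correction is (-1)^n, and n is even. The exponent (n choose 2) - 1
-- is (n choose 2) less the factor q that orthogonality puts in front of the count. The choice of
-- ν_β coordinates for each β is not made into a bijection. Both sides are treated as linear
-- functionals of a test function of weight and dot product, and one further coordinate of the code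
-- amounts to Pascal's rule.

-- Integer sums over finite lists

∑ : {A : Set} → List A → (A → ℤ) → ℤ
∑ xs f = List.foldr ℤ._+_ (pos 0) (List.map f xs)

𝟙 : {P : Set} → Dec P → ℤ
𝟙 d = if does d then pos 1 else pos 0

𝟙-yes : {P : Set} (d : Dec P) → P → 𝟙 d ≡ pos 1
𝟙-yes d p = cong (if_then pos 1 else pos 0) (dec-true d p)

𝟙-no : {P : Set} (d : Dec P) → ¬ P → 𝟙 d ≡ pos 0
𝟙-no d ¬p = cong (if_then pos 1 else pos 0) (dec-false d ¬p)

𝟙-⇔ : {P Q : Set} (d : Dec P) (e : Dec Q) → (P → Q) → (Q → P) → 𝟙 d ≡ 𝟙 e
𝟙-⇔ d (yes y) f g = 𝟙-yes d (g y)
𝟙-⇔ d (no n)  f g = 𝟙-no d (n ∘ f)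

ℤ+-congˡ : (a : ℤ) {b c : ℤ} → b ≡ c → a ℤ.+ b ≡ a ℤ.+ c
ℤ+-congˡ a = cong (λ z → a ℤ.+ z)

ℤ*-congˡ : (a : ℤ) {b c : ℤ} → b ≡ c → a ℤ.* b ≡ a ℤ.* c
ℤ*-congˡ a = cong (λ z → a ℤ.* z)

ℤ*-leftComm : ∀ a b c → a ℤ.* (b ℤ.* c) ≡ b ℤ.* (a ℤ.* c)
ℤ*-leftComm = ℤSolver.solve-∀

module _ {A : Set} where

  ∑-cong : (xs : List A) {f g : A → ℤ} → (∀ x → f x ≡ g x) → ∑ xs f ≡ ∑ xs g
  ∑-cong []       e = refl
  ∑-cong (x ∷ xs) e = cong₂ ℤ._+_ (e x) (∑-cong xs e)

  ∑-zero : (xs : List A) → ∑ xs (λ _ → pos 0) ≡ pos 0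
  ∑-zero []       = refl
  ∑-zero (x ∷ xs) = trans (ℤₚ.+-identityˡ _) (∑-zero xs)

  ∑-+ : (xs : List A) (f g : A → ℤ) → ∑ xs (λ x → f x ℤ.+ g x) ≡ ∑ xs f ℤ.+ ∑ xs g
  ∑-+ []       f g = refl
  ∑-+ (x ∷ xs) f g = trans (ℤ+-congˡ (f x ℤ.+ g x) (∑-+ xs f g)) (lem (f x) (g x) (∑ xs f) (∑ xs g))
    where
    lem : ∀ a b c d → a ℤ.+ b ℤ.+ (c ℤ.+ d) ≡ a ℤ.+ c ℤ.+ (b ℤ.+ d)
    lem = ℤSolver.solve-∀

  ∑-*ˡ : (c : ℤ) (xs : List A) (f : A → ℤ) → ∑ xs (λ x → c ℤ.* f x) ≡ c ℤ.* ∑ xs f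
  ∑-*ˡ c []       f = sym (ℤₚ.*-zeroʳ c)
  ∑-*ˡ c (x ∷ xs) f = trans (ℤ+-congˡ (c ℤ.* f x) (∑-*ˡ c xs f)) (sym (ℤₚ.*-distribˡ-+ c (f x) (∑ xs f)))

  ∑-const : (xs : List A) (c : ℤ) → ∑ xs (λ _ → c) ≡ pos (length xs) ℤ.* c
  ∑-const []       c = sym (ℤₚ.*-zeroˡ c)
  ∑-const (x ∷ xs) c = trans (ℤ+-congˡ c (∑-const xs c)) (sym (ℤₚ.suc-* (pos (length xs)) c))

  ∑-++ : (xs ys : List A) (f : A → ℤ) → ∑ (xs ++ ys) f ≡ ∑ xs f ℤ.+ ∑ ys f
  ∑-++ []       ys f = sym (ℤₚ.+-identityˡ _)
  ∑-++ (x ∷ xs) ys f = trans (ℤ+-congˡ (f x) (∑-++ xs ys f)) (sym (ℤₚ.+-assoc (f x) (∑ xs f) (∑ ys f)))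

  ∑-filter : {P : A → Set} (P? : ∀ x → Dec (P x)) (xs : List A) (f : A → ℤ) →
             ∑ (filter P? xs) f ≡ ∑ xs (λ x → 𝟙 (P? x) ℤ.* f x)
  ∑-filter P? []       f = refl
  ∑-filter P? (x ∷ xs) f with does (P? x)
  ... | true  = cong₂ ℤ._+_ (sym (ℤₚ.*-identityˡ (f x))) (∑-filter P? xs f)
  ... | false = trans (∑-filter P? xs f) (sym (ℤₚ.+-identityˡ _))

  ∑-filter-cong : {P : A → Set} (P? : ∀ x → Dec (P x)) (xs : List A) {f g : A → ℤ} →
                  (∀ x → P x → f x ≡ g x) → ∑ (filter P? xs) f ≡ ∑ (filter P? xs) g
  ∑-filter-cong P? []       e = refl
  ∑-filter-cong P? (x ∷ xs) e with P? x
  ... | yes p = cong₂ ℤ._+_ (e x p) (∑-filter-cong P? xs e)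
  ... | no  _ = ∑-filter-cong P? xs e

  length-∑ : (xs : List A) → pos (length xs) ≡ ∑ xs (λ _ → pos 1)
  length-∑ xs = sym (trans (∑-const xs (pos 1)) (ℤₚ.*-identityʳ _))

  length-filter-∑ : {P : A → Set} (P? : ∀ x → Dec (P x)) (xs : List A) →
                    pos (length (filter P? xs)) ≡ ∑ xs (λ x → 𝟙 (P? x))
  length-filter-∑ P? xs = begin
    pos (length (filter P? xs))      ≡⟨ length-∑ (filter P? xs) ⟩
    ∑ (filter P? xs) (λ _ → pos 1)   ≡⟨ ∑-filter P? xs _ ⟩
    ∑ xs (λ x → 𝟙 (P? x) ℤ.* pos 1)  ≡⟨ ∑-cong xs (λ x → ℤₚ.*-identityʳ _) ⟩
    ∑ xs (λ x → 𝟙 (P? x))            ∎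

∑-map : {A B : Set} (h : A → B) (xs : List A) (f : B → ℤ) → ∑ (List.map h xs) f ≡ ∑ xs (f ∘ h)
∑-map h []       f = refl
∑-map h (x ∷ xs) f = ℤ+-congˡ (f (h x)) (∑-map h xs f)

∑-concatMap : {A B : Set} (h : A → List B) (xs : List A) (f : B → ℤ) →
              ∑ (concatMap h xs) f ≡ ∑ xs (λ x → ∑ (h x) f)
∑-concatMap h []       f = refl
∑-concatMap h (x ∷ xs) f = trans (∑-++ (h x) (concatMap h xs) f) (ℤ+-congˡ (∑ (h x) f) (∑-concatMap h xs f))

∑-swap : {A B : Set} (xs : List A) (ys : List B) (f : A → B → ℤ) →
         ∑ xs (λ x → ∑ ys (f x)) ≡ ∑ ys (λ y → ∑ xs (λ x → f x y))
∑-swap []       ys f = sym (∑-zero ys)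
∑-swap (x ∷ xs) ys f = trans (ℤ+-congˡ (∑ ys (f x)) (∑-swap xs ys f)) (sym (∑-+ ys (f x) _))

∑-Fin-suc : ∀ n (f : Fin (suc n) → ℤ) → ∑ (allFin (suc n)) f ≡ f zero ℤ.+ ∑ (allFin n) (f ∘ suc)
∑-Fin-suc n f = ℤ+-congˡ (f zero) (trans (cong (λ l → ∑ l f) (sym (Listₚ.map-tabulate id suc))) (∑-map suc (allFin n) f))

∑-Fin-single : ∀ {n} (c : Fin n) (f : Fin n → ℤ) → (∀ x → x ≢ c → f x ≡ pos 0) → ∑ (allFin n) f ≡ f c
∑-Fin-single {suc n} zero f h = begin
  ∑ (allFin (suc n)) f               ≡⟨ ∑-Fin-suc n f ⟩
  f zero ℤ.+ ∑ (allFin n) (f ∘ suc)  ≡⟨ ℤ+-congˡ (f zero) (trans (∑-cong (allFin n) (λ x → h (suc x) λ ())) (∑-zero (allFin n))) ⟩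
  f zero ℤ.+ pos 0                   ≡⟨ ℤₚ.+-identityʳ _ ⟩
  f zero                             ∎
∑-Fin-single {suc n} (suc c) f h = begin
  ∑ (allFin (suc n)) f               ≡⟨ ∑-Fin-suc n f ⟩
  f zero ℤ.+ ∑ (allFin n) (f ∘ suc)  ≡⟨ cong₂ ℤ._+_ (h zero λ ()) (∑-Fin-single c (f ∘ suc) (λ x x≢c → h (suc x) (x≢c ∘ Finₚ.suc-injective))) ⟩
  pos 0 ℤ.+ f (suc c)                ≡⟨ ℤₚ.+-identityˡ _ ⟩
  f (suc c)                          ∎

∑-Fin-pick : ∀ {n} (c : Fin n) (f : Fin n → ℤ) → ∑ (allFin n) (λ x → 𝟙 (x ≟F c) ℤ.* f x) ≡ f c
∑-Fin-pick c f = begin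
  ∑ (allFin _) (λ x → 𝟙 (x ≟F c) ℤ.* f x)  ≡⟨ ∑-Fin-single c _ (λ x x≢c → cong (ℤ._* f x) (𝟙-no (x ≟F c) x≢c)) ⟩
  𝟙 (c ≟F c) ℤ.* f c                       ≡⟨ cong (ℤ._* f c) (𝟙-yes (c ≟F c) refl) ⟩
  pos 1 ℤ.* f c                            ≡⟨ ℤₚ.*-identityˡ (f c) ⟩
  f c                                      ∎

-- Introduce a second variable `y` through the indicator of `y ≡ π x` and exchange the sums: the
-- same indicator, read as `x ≡ π⁻¹ y`, picks exactly one `x` for each `y`.
∑-Fin-permute : ∀ {n} (π π⁻¹ : Fin n → Fin n) → (∀ x → π (π⁻¹ x) ≡ x) → (∀ x → π⁻¹ (π x) ≡ x) →
                (f : Fin n → ℤ) → ∑ (allFin n) (f ∘ π) ≡ ∑ (allFin n) f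
∑-Fin-permute {n} π π⁻¹ ππ⁻¹ π⁻¹π f = begin
  ∑ E (f ∘ π)                                      ≡⟨ ∑-cong E (λ x → sym (∑-Fin-pick (π x) f)) ⟩
  ∑ E (λ x → ∑ E (λ y → 𝟙 (y ≟F π x) ℤ.* f y))     ≡⟨ ∑-swap E E _ ⟩
  ∑ E (λ y → ∑ E (λ x → 𝟙 (y ≟F π x) ℤ.* f y))     ≡⟨ ∑-cong E (λ y → ∑-cong E (λ x → cong (ℤ._* f y)
                                                        (𝟙-⇔ (y ≟F π x) (x ≟F π⁻¹ y)
                                                          (λ e → sym (trans (cong π⁻¹ e) (π⁻¹π x)))
                                                          (λ e → sym (trans (cong π e) (ππ⁻¹ y)))))) ⟩
  ∑ E (λ y → ∑ E (λ x → 𝟙 (x ≟F π⁻¹ y) ℤ.* f y))   ≡⟨ ∑-cong E (λ y → ∑-Fin-pick (π⁻¹ y) (λ _ → f y)) ⟩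
  ∑ E f                                            ∎
  where E = allFin n

-- Finite field arithmetic: the theorems of Lagrange and Fermat

module FieldArithmetic {q : ℕ} (F : FiniteField q) where
  open FiniteField F renaming (_+_ to infixl 6 _+_; _*_ to infixl 7 _*_)
  open FieldDefs F

  commutativeRing : CommutativeRing 0ℓ 0ℓ
  commutativeRing = record { isCommutativeRing = isCommutativeRing }

  open CommutativeRing commutativeRing public
    using (+-assoc; +-comm; +-identityˡ; +-identityʳ; *-assoc; *-comm; *-identityˡ; *-identityʳ; distribˡ; zeroˡ; zeroʳ;
           commutativeSemiring; semiring; *-commutativeMonoid)
    renaming (-‿inverseˡ to +-inverseˡ)

  module Add = Algebra.Properties.Semiring.Sum semiring
  module Mul = Algebra.Properties.CommutativeMonoid.Sum *-commutativeMonoid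
  open Algebra.Properties.Group (CommutativeRing.+-group commutativeRing) public
    using () renaming (∙-cancelˡ to +-cancelˡ; ∙-cancelʳ to +-cancelʳ)
  module Solver = Algebra.Solver.Ring.NaturalCoefficients.Default commutativeSemiring
  open Solver using (solve; _:+_; _:*_; _:=_)

  ∑-allVecs : {A : Set} (xs : List A) (n : ℕ) (f : Vec A (suc n) → ℤ) →
              ∑ (allVecs xs (suc n)) f ≡ ∑ xs (λ x → ∑ (allVecs xs n) (λ v → f (x ∷ v)))
  ∑-allVecs xs n f = trans (∑-concatMap (λ x → List.map (x ∷_) (allVecs xs n)) xs f)
    (∑-cong xs (λ x → ∑-map (x ∷_) (allVecs xs n) f))

  inverseˡ : ∀ x → x ≢ 0# → (x ⁻¹) * x ≡ 1#
  inverseˡ x x≢0 = trans (*-comm _ x) (inverseʳ x x≢0)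

  *-cancel-inverseˡ : ∀ x y → x ≢ 0# → (x ⁻¹) * (x * y) ≡ y
  *-cancel-inverseˡ x y x≢0 = begin
    (x ⁻¹) * (x * y)  ≡⟨ *-assoc _ x y ⟨
    ((x ⁻¹) * x) * y  ≡⟨ cong (_* y) (inverseˡ x x≢0) ⟩
    1# * y            ≡⟨ *-identityˡ y ⟩
    y                 ∎

  *-cancel-inverseʳ : ∀ x y → x ≢ 0# → x * ((x ⁻¹) * y) ≡ y
  *-cancel-inverseʳ x y x≢0 = begin
    x * ((x ⁻¹) * y)  ≡⟨ *-assoc x _ y ⟨
    (x * (x ⁻¹)) * y  ≡⟨ cong (_* y) (inverseʳ x x≢0) ⟩
    1# * y            ≡⟨ *-identityˡ y ⟩
    y                 ∎

  *-cancelˡ : ∀ x {y z} → x ≢ 0# → x * y ≡ x * z → y ≡ z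
  *-cancelˡ x {y} {z} x≢0 e = begin
    y                 ≡⟨ *-cancel-inverseˡ x y x≢0 ⟨
    (x ⁻¹) * (x * y)  ≡⟨ cong ((x ⁻¹) *_) e ⟩
    (x ⁻¹) * (x * z)  ≡⟨ *-cancel-inverseˡ x z x≢0 ⟩
    z                 ∎

  *-nonzero : ∀ {x y} → x ≢ 0# → y ≢ 0# → x * y ≢ 0#
  *-nonzero {x} x≢0 y≢0 e = y≢0 (*-cancelˡ x x≢0 (trans e (sym (zeroʳ x))))

  *≡1⇒nonzeroˡ : ∀ {x y} → x * y ≡ 1# → x ≢ 0#
  *≡1⇒nonzeroˡ {x} {y} e x≡0 = 0≢1 (trans (sym (zeroˡ y)) (trans (cong (_* y) (sym x≡0)) e))

  ⁻¹-nonzero : ∀ {x} → x ≢ 0# → (x ⁻¹) ≢ 0#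
  ⁻¹-nonzero {x} x≢0 = *≡1⇒nonzeroˡ (inverseˡ x x≢0)

  ⁻¹-unique : ∀ {x y} → x * y ≡ 1# → y ≡ x ⁻¹
  ⁻¹-unique {x} e = *-cancelˡ x x≢0 (trans e (sym (inverseʳ x x≢0)))
    where x≢0 = *≡1⇒nonzeroˡ e

  ⁻¹-* : ∀ {x y} → x ≢ 0# → y ≢ 0# → (x * y) ⁻¹ ≡ (x ⁻¹) * (y ⁻¹)
  ⁻¹-* {x} {y} x≢0 y≢0 = sym (⁻¹-unique (begin
    (x * y) * ((x ⁻¹) * (y ⁻¹))  ≡⟨ solve 4 (λ a b c d → (a :* b) :* (c :* d) := (a :* c) :* (b :* d)) refl x y (x ⁻¹) (y ⁻¹) ⟩
    (x * (x ⁻¹)) * (y * (y ⁻¹))  ≡⟨ cong₂ _*_ (inverseʳ x x≢0) (inverseʳ y y≢0) ⟩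
    1# * 1#                      ≡⟨ *-identityˡ 1# ⟩
    1#                           ∎))

  1⁻¹≡1 : 1# ⁻¹ ≡ 1#
  1⁻¹≡1 = sym (⁻¹-unique (*-identityˡ 1#))

  pow-+ : ∀ x m n → pow x (m ℕ.+ n) ≡ pow x m * pow x n
  pow-+ x zero    n = sym (*-identityˡ _)
  pow-+ x (suc m) n = trans (cong (x *_) (pow-+ x m n)) (sym (*-assoc x _ _))

  pow-nonzero : ∀ {x} n → x ≢ 0# → pow x n ≢ 0#
  pow-nonzero zero    x≢0 e = 0≢1 (sym e)
  pow-nonzero (suc n) x≢0   = *-nonzero x≢0 (pow-nonzero n x≢0)

  pow≡0⇒≡0 : ∀ {x} n → pow x n ≡ 0# → x ≡ 0#
  pow≡0⇒≡0 {x} n e with x ≟F 0#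
  ... | yes p = p
  ... | no ¬p = ⊥-elim (pow-nonzero n ¬p e)

  smul-+ : ∀ m n x → smul (m ℕ.+ n) x ≡ smul m x + smul n x
  smul-+ zero    n x = sym (+-identityˡ _)
  smul-+ (suc m) n x = trans (cong (x +_) (smul-+ m n x)) (sym (+-assoc x _ _))

  sum-const : ∀ n x → Add.sum {n} (λ _ → x) ≡ smul n x
  sum-const zero    x = refl
  sum-const (suc n) x = cong (x +_) (sum-const n x)

  product-const : ∀ n x → Mul.sum {n} (λ _ → x) ≡ pow x n
  product-const zero    x = refl
  product-const (suc n) x = cong (x *_) (product-const n x)

  -- Translation by `x` permutes the field, so the sum `S` of all its elements equals itself plus
  -- `q` copies of `x`.
  smul-order : ∀ x → smul q x ≡ 0#
  smul-order x = +-cancelˡ S _ _ (begin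
    S + smul q x                           ≡⟨ cong (S +_) (sum-const q x) ⟨
    S + Add.sum {q} (λ _ → x)              ≡⟨ Add.∑-distrib-+ id (λ _ → x) ⟨
    Add.sum {q} (λ y → y + x)              ≡⟨ Add.sum-permute id (permutation (_+ x) (_+ (- x)) inv₁ inv₂) ⟨
    S                                      ≡⟨ +-identityʳ S ⟨
    S + 0#                                 ∎)
    where
    S = Add.sum {q} id
    inv₁ : ∀ y → (y + (- x)) + x ≡ y
    inv₁ y = trans (+-assoc y _ x) (trans (cong (y +_) (+-inverseˡ x)) (+-identityʳ y))
    inv₂ : ∀ y → (y + x) + (- x) ≡ y
    inv₂ y = trans (+-assoc y x _) (trans (cong (y +_) (trans (+-comm x _) (+-inverseˡ x))) (+-identityʳ y))

  -- Expresses x^(n-1) without subtraction, as a product over all of `Fin n` with the factor 1 at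
  -- the omitted place `c`.
  product-except : ∀ {n} x (c : Fin n) → x * Mul.sum (λ y → if does (y ≟F c) then 1# else x) ≡ pow x n
  product-except {suc n} x zero    = cong (x *_) (trans (*-identityˡ _) (product-const n x))
  product-except {suc n} x (suc c) = cong (x *_) (product-except x c)

  product-nonzero : ∀ {n} (f : Fin n → Elt) → (∀ i → f i ≢ 0#) → Mul.sum f ≢ 0#
  product-nonzero {zero}  f h e = 0≢1 (sym e)
  product-nonzero {suc n} f h   = *-nonzero (h zero) (product-nonzero (f ∘ suc) (h ∘ suc))

  -- Multiplication by `x` permutes the nonzero elements. With 0 replaced by 1, as `h` does, their
  -- product `P` runs over the whole of `Fin q`; comparing it before and after the permutation gives
  -- P x^(q-1) = P, and `P` is nonzero.
  pow-order-nonzero : ∀ {x} → x ≢ 0# → pow x q ≡ x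
  pow-order-nonzero {x} x≢0 = begin
    pow x q        ≡⟨ product-except x 0# ⟨
    x * Mul.sum g  ≡⟨ cong (x *_) (*-cancelˡ P (product-nonzero h h≢0) (trans P*∏g (sym (*-identityʳ P)))) ⟩
    x * 1#         ≡⟨ *-identityʳ x ⟩
    x              ∎
    where
    g h : Elt → Elt
    g y = if does (y ≟F 0#) then 1# else x
    h y = if does (y ≟F 0#) then 1# else y
    P = Mul.sum h
    h≢0 : ∀ y → h y ≢ 0#
    h≢0 y with y ≟F 0#
    ... | yes _ = 0≢1 ∘ sym
    ... | no ¬p = ¬p
    h-* : ∀ y → h (x * y) ≡ h y * g y
    h-* y with y ≟F 0#
    ... | yes p rewrite dec-true ((x * y) ≟F 0#) (trans (cong (x *_) p) (zeroʳ x)) = sym (*-identityˡ 1#)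
    ... | no ¬p rewrite dec-false ((x * y) ≟F 0#) (*-nonzero x≢0 ¬p) = *-comm x y
    P*∏g : P * Mul.sum g ≡ P
    P*∏g = begin
      P * Mul.sum g                    ≡⟨ Mul.∑-distrib-+ h g ⟨
      Mul.sum (λ y → h y * g y)        ≡⟨ Mul.sum-cong-≗ h-* ⟨
      Mul.sum (λ y → h (x * y))        ≡⟨ Mul.sum-permute h (permutation (x *_) ((x ⁻¹) *_)
                                            (λ y → *-cancel-inverseʳ x y x≢0) (λ y → *-cancel-inverseˡ x y x≢0)) ⟨
      P                                ∎

-- Characteristic 2: Frobenius map, absolute trace and the character λ

module TwoPower (r : ℕ) {q : ℕ} (q≡2^r : q ≡ 2 ^ r) (F : FiniteField q) where
  open FiniteField F renaming (_+_ to infixl 6 _+_; _*_ to infixl 7 _*_)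
  open FieldDefs F
  open FieldArithmetic F public
  open Solver using (solve; _:+_; _:*_; _:=_)

  smul-2^ : ∀ k → smul (2 ^ k) 1# ≡ pow (1# + 1#) k
  smul-2^ zero    = +-identityʳ 1#
  smul-2^ (suc k) = begin
    smul (2 ^ k ℕ.+ (2 ^ k ℕ.+ 0)) 1#            ≡⟨ cong (λ m → smul (2 ^ k ℕ.+ m) 1#) (ℕₚ.+-identityʳ (2 ^ k)) ⟩
    smul (2 ^ k ℕ.+ 2 ^ k) 1#                    ≡⟨ smul-+ (2 ^ k) (2 ^ k) 1# ⟩
    smul (2 ^ k) 1# + smul (2 ^ k) 1#            ≡⟨ cong (λ z → z + z) (smul-2^ k) ⟩
    pow (1# + 1#) k + pow (1# + 1#) k            ≡⟨ cong₂ _+_ (*-identityˡ _) (*-identityˡ _) ⟨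
    1# * pow (1# + 1#) k + 1# * pow (1# + 1#) k  ≡⟨ CommutativeRing.distribʳ commutativeRing _ 1# 1# ⟨
    (1# + 1#) * pow (1# + 1#) k                  ∎

  -- The `q`-fold sum of 1 vanishes and, since q = 2^r, it is also (1 + 1)^r; a field has no nonzero
  -- nilpotent element.
  1+1≡0 : 1# + 1# ≡ 0#
  1+1≡0 = pow≡0⇒≡0 r (trans (sym (smul-2^ r)) (trans (cong (λ m → smul m 1#) (sym q≡2^r)) (smul-order 1#)))

  x+x≡0 : ∀ x → x + x ≡ 0#
  x+x≡0 x = begin
    x + x              ≡⟨ cong₂ _+_ (*-identityʳ x) (*-identityʳ x) ⟨
    x * 1# + x * 1#    ≡⟨ distribˡ x 1# 1# ⟨
    x * (1# + 1#)      ≡⟨ cong (x *_) 1+1≡0 ⟩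
    x * 0#             ≡⟨ zeroʳ x ⟩
    0#                 ∎

  x+[x+y]≡y : ∀ x y → x + (x + y) ≡ y
  x+[x+y]≡y x y = trans (sym (+-assoc x x y)) (trans (cong (_+ y) (x+x≡0 x)) (+-identityˡ y))

  [x+y]+y≡x : ∀ x y → (x + y) + y ≡ x
  [x+y]+y≡x x y = trans (+-assoc x y y) (trans (cong (x +_) (x+x≡0 y)) (+-identityʳ x))

  x+y≡0⇒x≡y : ∀ {x y} → x + y ≡ 0# → x ≡ y
  x+y≡0⇒x≡y {x} {y} e = +-cancelʳ y x y (trans e (sym (x+x≡0 y)))

  neg≡id : ∀ x → - x ≡ x
  neg≡id x = x+y≡0⇒x≡y (+-inverseˡ x)

  sign≡1 : ∀ k → sign k ≡ 1#
  sign≡1 zero    = refl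
  sign≡1 (suc k) = trans (neg≡id _) (sign≡1 k)

  sq : Elt → Elt
  sq x = x * x

  sq-+ : ∀ x y → sq (x + y) ≡ sq x + sq y
  sq-+ x y = begin
    (x + y) * (x + y)                ≡⟨ solve 2 (λ a b → (a :+ b) :* (a :+ b) := (a :* b :+ a :* b) :+ (a :* a :+ b :* b)) refl x y ⟩
    (x * y + x * y) + (sq x + sq y)  ≡⟨ cong (_+ (sq x + sq y)) (x+x≡0 (x * y)) ⟩
    0# + (sq x + sq y)               ≡⟨ +-identityˡ _ ⟩
    sq x + sq y                      ∎

  sq-* : ∀ x y → sq (x * y) ≡ sq x * sq y
  sq-* = solve 2 (λ a b → (a :* b) :* (a :* b) := (a :* a) :* (b :* b)) refl

  frob : ℕ → Elt → Elt
  frob zero    x = x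
  frob (suc k) x = sq (frob k x)

  pow-2^ : ∀ k x → pow x (2 ^ k) ≡ frob k x
  pow-2^ zero    x = *-identityʳ x
  pow-2^ (suc k) x = begin
    pow x (2 ^ k ℕ.+ (2 ^ k ℕ.+ 0))  ≡⟨ cong (λ m → pow x (2 ^ k ℕ.+ m)) (ℕₚ.+-identityʳ (2 ^ k)) ⟩
    pow x (2 ^ k ℕ.+ 2 ^ k)          ≡⟨ pow-+ x (2 ^ k) (2 ^ k) ⟩
    sq (pow x (2 ^ k))               ≡⟨ cong sq (pow-2^ k x) ⟩
    sq (frob k x)                    ∎

  frob-+ : ∀ k x y → frob k (x + y) ≡ frob k x + frob k y
  frob-+ zero    x y = refl
  frob-+ (suc k) x y = trans (cong sq (frob-+ k x y)) (sq-+ (frob k x) (frob k y))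

  frob-sq : ∀ k x → frob k (sq x) ≡ frob (suc k) x
  frob-sq zero    x = refl
  frob-sq (suc k) x = cong sq (frob-sq k x)

  frob-0 : ∀ k → frob k 0# ≡ 0#
  frob-0 zero    = refl
  frob-0 (suc k) = trans (cong sq (frob-0 k)) (zeroˡ 0#)

  frob-order : ∀ x → frob r x ≡ x
  frob-order x with x ≟F 0#
  ... | yes refl = frob-0 r
  ... | no x≢0 = trans (sym (pow-2^ r x)) (trans (cong (pow x) (sym q≡2^r)) (pow-order-nonzero x≢0))

  -- absTr in a form where T (1 + m) is visibly monic of degree 2^m.
  T : ℕ → Elt → Elt
  T zero    x = 0#
  T (suc m) x = T m x + frob m x

  sumF-++ : ∀ xs ys → sumF (xs ++ ys) ≡ sumF xs + sumF ys
  sumF-++ []       ys = sym (+-identityˡ _)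
  sumF-++ (x ∷ xs) ys = trans (cong (x +_) (sumF-++ xs ys)) (sym (+-assoc x _ _))

  absTr≡T : ∀ m x → absTr m x ≡ T m x
  absTr≡T zero    x = refl
  absTr≡T (suc m) x = begin
    sumF (List.map f (upTo (suc m)))             ≡⟨ cong (sumF ∘ List.map f) (Listₚ.upTo-∷ʳ m) ⟨
    sumF (List.map f (upTo m ++ m ∷ []))         ≡⟨ cong sumF (Listₚ.map-++ f (upTo m) (m ∷ [])) ⟩
    sumF (List.map f (upTo m) ++ f m ∷ [])       ≡⟨ sumF-++ (List.map f (upTo m)) _ ⟩
    absTr m x + (f m + 0#)                       ≡⟨ cong₂ _+_ (absTr≡T m x) (trans (+-identityʳ _) (pow-2^ m x)) ⟩
    T m x + frob m x                             ∎
    where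
    f : ℕ → Elt
    f k = pow x (2 ^ k)

  T-+ : ∀ m x y → T m (x + y) ≡ T m x + T m y
  T-+ zero    x y = sym (+-identityˡ 0#)
  T-+ (suc m) x y = trans (cong₂ _+_ (T-+ m x y) (frob-+ m x y))
    (solve 4 (λ a b c d → (a :+ b) :+ (c :+ d) := (a :+ c) :+ (b :+ d)) refl (T m x) (T m y) (frob m x) (frob m y))

  T-sq : ∀ m x → T m (sq x) ≡ sq (T m x)
  T-sq zero    x = sym (zeroˡ 0#)
  T-sq (suc m) x = trans (cong₂ _+_ (T-sq m x) (frob-sq m x)) (sym (sq-+ (T m x) (frob m x)))

  -- Both sides are the sum of x^(2^k) over 0 ≤ k ≤ m. For m = r the loose terms x and x^q coincide,
  -- which makes the trace invariant under squaring.
  T-telescope : ∀ m x → T m (sq x) + x ≡ T m x + frob m x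
  T-telescope zero    x = refl
  T-telescope (suc m) x = begin
    (T m (sq x) + frob m (sq x)) + x  ≡⟨ solve 3 (λ a b c → (a :+ b) :+ c := (a :+ c) :+ b) refl (T m (sq x)) (frob m (sq x)) x ⟩
    (T m (sq x) + x) + frob m (sq x)  ≡⟨ cong₂ _+_ (T-telescope m x) (frob-sq m x) ⟩
    (T m x + frob m x) + frob (suc m) x ∎

  T-sq-invariant : ∀ x → T r (sq x) ≡ T r x
  T-sq-invariant x = +-cancelʳ x _ _ (trans (T-telescope r x) (cong (T r x +_) (frob-order x)))

  -- The trace commutes with squaring and is invariant under it, so it is its own square. Since
  -- `addChar` only tests whether a trace is 0, multiplicativity of λ depends on this: two nonzero
  -- traces must add up to 0.
  T-binary : ∀ x → T r x ≢ 0# → T r x ≡ 1#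
  T-binary x T≢0 = *-cancelˡ (T r x) T≢0 (begin
    sq (T r x)    ≡⟨ T-sq r x ⟨
    T r (sq x)    ≡⟨ T-sq-invariant x ⟩
    T r x         ≡⟨ *-identityʳ _ ⟨
    T r x * 1#    ∎)

  lam : Elt → ℤ
  lam = addChar r

  lam-yes : ∀ x → T r x ≡ 0# → lam x ≡ pos 1
  lam-yes x e = cong (if_then pos 1 else -[1+ 0 ]) (dec-true (absTr r x ≟F 0#) (trans (absTr≡T r x) e))

  lam-no : ∀ x → T r x ≢ 0# → lam x ≡ -[1+ 0 ]
  lam-no x e = cong (if_then pos 1 else -[1+ 0 ]) (dec-false (absTr r x ≟F 0#) (e ∘ trans (sym (absTr≡T r x))))

  lam-+ : ∀ x y → lam (x + y) ≡ lam x ℤ.* lam y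
  lam-+ x y with T r x ≟F 0# | T r y ≟F 0#
  ... | yes p | yes p′ = trans (lam-yes _ (trans (T-+ r x y) (trans (cong₂ _+_ p p′) (+-identityˡ 0#))))
                               (sym (cong₂ ℤ._*_ (lam-yes x p) (lam-yes y p′)))
  ... | yes p | no ¬p′ = trans (lam-no _ (λ e → ¬p′ (trans (sym (trans (T-+ r x y) (trans (cong (_+ _) p) (+-identityˡ _)))) e)))
                               (sym (cong₂ ℤ._*_ (lam-yes x p) (lam-no y ¬p′)))
  ... | no ¬p | yes p′ = trans (lam-no _ (λ e → ¬p (trans (sym (trans (T-+ r x y) (trans (cong (_ +_) p′) (+-identityʳ _)))) e)))
                               (sym (cong₂ ℤ._*_ (lam-no x ¬p) (lam-yes y p′)))
  ... | no ¬p | no ¬p′ = trans (lam-yes _ (trans (T-+ r x y) (trans (cong₂ _+_ (T-binary x ¬p) (T-binary y ¬p′)) 1+1≡0)))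
                               (sym (cong₂ ℤ._*_ (lam-no x ¬p) (lam-no y ¬p′)))

  T-0 : ∀ m → T m 0# ≡ 0#
  T-0 m = +-cancelʳ (T m 0#) _ _ (trans (sym (T-+ m 0# 0#)) (trans (cong (T m) (+-identityˡ 0#)) (sym (+-identityˡ _))))

  lam-0 : lam 0# ≡ pos 1
  lam-0 = lam-yes 0# (T-0 r)

  lam-sq : ∀ x → lam (sq x) ≡ lam x
  lam-sq x with T r x ≟F 0#
  ... | yes p = trans (lam-yes _ (trans (T-sq-invariant x) p)) (sym (lam-yes x p))
  ... | no ¬p = trans (lam-no _ (λ e → ¬p (trans (sym (T-sq-invariant x)) e))) (sym (lam-no x ¬p))

  -- Polynomial functions in Horner form: `Poly d` stands for degree below `d`, `Monic d` for degree
  -- `d` with leading coefficient 1. Both are predicates on functions, since only values are ever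
  -- compared.
  Poly : ℕ → (Elt → Elt) → Set
  Poly zero    f = ∀ x → f x ≡ 0#
  Poly (suc d) f = ∃ λ c → ∃ λ g → Poly d g × (∀ x → f x ≡ c + x * g x)

  Monic : ℕ → (Elt → Elt) → Set
  Monic zero    f = ∀ x → f x ≡ 1#
  Monic (suc d) f = ∃ λ c → ∃ λ g → Monic d g × (∀ x → f x ≡ c + x * g x)

  Monic⇒Poly : ∀ d {f} → Monic d f → Poly (suc d) f
  Monic⇒Poly zero    m = 1# , (λ _ → 0#) , (λ _ → refl) ,
    λ x → trans (m x) (sym (trans (cong (1# +_) (zeroʳ x)) (+-identityʳ 1#)))
  Monic⇒Poly (suc d) (c , g , m , e) = c , g , Monic⇒Poly d m , e

  Poly-weaken : ∀ d {f} → Poly d f → Poly (suc d) f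
  Poly-weaken zero    p = 0# , (λ _ → 0#) , (λ _ → refl) ,
    λ x → trans (p x) (sym (trans (cong (0# +_) (zeroʳ x)) (+-identityʳ 0#)))
  Poly-weaken (suc d) (c , g , p , e) = c , g , Poly-weaken d p , e

  Poly-≤ : ∀ {d e f} → d ℕ.≤′ e → Poly d f → Poly e f
  Poly-≤ ℕ.≤′-refl     p = p
  Poly-≤ (ℕ.≤′-step l) p = Poly-weaken _ (Poly-≤ l p)

  Poly+pow : ∀ d {f} → Poly d f → Monic d (λ x → f x + pow x d)
  Poly+pow zero    p = λ x → trans (cong (_+ 1#) (p x)) (+-identityˡ 1#)
  Poly+pow (suc d) {f} (c , g , p , e) = c , (λ x → g x + pow x d) , Poly+pow d p , λ x → begin
    f x + x * pow x d              ≡⟨ cong (_+ x * pow x d) (e x) ⟩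
    (c + x * g x) + x * pow x d    ≡⟨ solve 4 (λ c x g p → (c :+ x :* g) :+ x :* p := c :+ x :* (g :+ p)) refl c x (g x) (pow x d) ⟩
    c + x * (g x + pow x d)        ∎

  Monic-cong : ∀ d {f f′} → (∀ x → f x ≡ f′ x) → Monic d f → Monic d f′
  Monic-cong zero    e m = λ x → trans (sym (e x)) (m x)
  Monic-cong (suc d) e (c , g , m , e′) = c , g , m , λ x → trans (sym (e x)) (e′ x)

  -- Synthetic division, with the sum in place of the difference. For f = c + x h one has f(x) +
  -- f(a) = (x + a) h(a) + x (h(x) + h(a)), and the last bracket is divisible by x + a by induction.
  factor : ∀ d {f} → Monic (suc d) f → ∀ a → ∃ λ g → Monic d g × (∀ x → f x + f a ≡ (x + a) * g x)
  factor zero {f} (c , h , h≡1 , e) a = (λ _ → 1#) , (λ _ → refl) , λ x → begin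
    f x + f a                          ≡⟨ cong₂ _+_ (trans (e x) (cong (λ z → c + x * z) (h≡1 x))) (trans (e a) (cong (λ z → c + a * z) (h≡1 a))) ⟩
    (c + x * 1#) + (c + a * 1#)        ≡⟨ solve 4 (λ c x a u → (c :+ x :* u) :+ (c :+ a :* u) := c :+ (c :+ (x :+ a) :* u)) refl c x a 1# ⟩
    c + (c + (x + a) * 1#)             ≡⟨ x+[x+y]≡y c _ ⟩
    (x + a) * 1#                       ∎
  factor (suc d) {f} (c , h , m , e) a with factor d m a
  ... | k , mk , ek = (λ x → h a + x * k x) , (h a , k , mk , λ _ → refl) , λ x → begin
    f x + f a                                       ≡⟨ cong₂ _+_ (e x) (e a) ⟩
    (c + x * h x) + (c + a * h a)                   ≡⟨ solve 5 (λ c x y a z → (c :+ x :* y) :+ (c :+ a :* z) := c :+ (c :+ (x :* y :+ a :* z))) refl c x (h x) a (h a) ⟩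
    c + (c + (x * h x + a * h a))                   ≡⟨ x+[x+y]≡y c _ ⟩
    x * h x + a * h a                               ≡⟨ x+[x+y]≡y (x * h a) _ ⟨
    x * h a + (x * h a + (x * h x + a * h a))       ≡⟨ solve 4 (λ x y a z → x :* z :+ (x :* z :+ (x :* y :+ a :* z)) := (x :+ a) :* z :+ x :* (y :+ z)) refl x (h x) a (h a) ⟩
    (x + a) * h a + x * (h x + h a)                 ≡⟨ cong (λ z → (x + a) * h a + x * z) (ek x) ⟩
    (x + a) * h a + x * ((x + a) * k x)             ≡⟨ solve 4 (λ x a z k → (x :+ a) :* z :+ x :* ((x :+ a) :* k) := (x :+ a) :* (z :+ x :* k)) refl x a (h a) (k x) ⟩
    (x + a) * (h a + x * k x)                       ∎

  -- Divide by x + ρ(0). This factor is nonzero at the other roots, so they are roots of the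
  -- quotient, whose degree is one less.
  root-bound : ∀ d {f} → Monic d f → (ρ : Fin (suc d) → Elt) → (∀ {i j} → ρ i ≡ ρ j → i ≡ j) →
               ¬ (∀ i → f (ρ i) ≡ 0#)
  root-bound zero    m ρ inj z = 0≢1 (trans (sym (z zero)) (m (ρ zero)))
  root-bound (suc d) {f} m ρ inj z with factor d m (ρ zero)
  ... | g , mg , eg = root-bound d mg (ρ ∘ suc) (Finₚ.suc-injective ∘ inj) λ i →
    *-cancelˡ (ρ (suc i) + ρ zero) (λ e → Finₚ.0≢1+n (inj (sym (x+y≡0⇒x≡y e)))) (begin
      (ρ (suc i) + ρ zero) * g (ρ (suc i))  ≡⟨ eg (ρ (suc i)) ⟨
      f (ρ (suc i)) + f (ρ zero)            ≡⟨ cong₂ _+_ (z (suc i)) (z zero) ⟩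
      0# + 0#                               ≡⟨ +-identityˡ 0# ⟩
      0#                                    ≡⟨ zeroʳ _ ⟨
      (ρ (suc i) + ρ zero) * 0#             ∎)

  1+2^m≤2^[1+m] : ∀ m → suc (2 ^ m) ≤ 2 ^ suc m
  1+2^m≤2^[1+m] m = ℕₚ.+-mono-≤ (ℕₚ.m^n>0 2 m) (ℕₚ.m≤m+n (2 ^ m) 0)

  -- The two statements alternate: `T m` has degree below 2^m, so the new term x^(2^m) makes
  -- `T (suc m)` monic of degree 2^m, which in turn is below 2^(m+1).
  T-Poly : ∀ m → Poly (2 ^ m) (T m)
  T-Monic : ∀ m → Monic (2 ^ m) (T (suc m))
  T-Poly zero    = 0# , (λ _ → 0#) , (λ _ → refl) , λ x → sym (trans (+-identityˡ _) (zeroʳ x))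
  T-Poly (suc m) = Poly-≤ (ℕₚ.≤⇒≤′ (1+2^m≤2^[1+m] m)) (Monic⇒Poly (2 ^ m) (T-Monic m))
  T-Monic m = Monic-cong (2 ^ m) (λ x → cong (T m x +_) (pow-2^ m x)) (Poly+pow (2 ^ m) (T-Poly m))

  T-nontrivial : 0 < r → ¬ (∀ x → T r x ≡ 0#)
  T-nontrivial 0<r = go r q≡2^r 0<r
    where
    go : ∀ m → q ≡ 2 ^ m → 0 < m → ¬ (∀ x → T m x ≡ 0#)
    -- With r = m + 1 the trace is monic of degree 2^m, while the field has 2^(m+1) ≥ 2^m + 1
    -- elements. The first 2^m + 1 labels serve as the distinct roots.
    go (suc m) e _ z = root-bound (2 ^ m) (T-Monic m) (λ i → Fin.inject≤ i le)
      (Finₚ.inject≤-injective le le _ _) (λ i → z _)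
      where
      le : suc (2 ^ m) ≤ q
      le = subst (suc (2 ^ m) ≤_) (sym e) (1+2^m≤2^[1+m] m)

  lam-nontrivial : 0 < r → ∃ λ t → lam t ≡ -[1+ 0 ]
  lam-nontrivial 0<r with Finₚ.¬∀⟶∃¬ q (λ x → T r x ≡ 0#) (λ x → T r x ≟F 0#) (T-nontrivial 0<r)
  ... | t , T≢0 = t , lam-no t T≢0

-- Determinants in characteristic 2

module Determinant (r : ℕ) {q : ℕ} (q≡2^r : q ≡ 2 ^ r) (F : FiniteField q) where
  open FiniteField F renaming (_+_ to infixl 6 _+_; _*_ to infixl 7 _*_)
  open FieldDefs F
  open TwoPower r q≡2^r F
  open Add using (sum; sum-cong-≗; ∑-distrib-+; *-distribˡ-sum; sum-replicate-zero)
  open Solver using (solve; _:+_; _:*_; _:=_)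

  sumF-tabulate : ∀ {n} (f : Fin n → Elt) → sumF (List.tabulate f) ≡ sum f
  sumF-tabulate {zero}  f = refl
  sumF-tabulate {suc n} f = cong (f zero +_) (sumF-tabulate (f ∘ suc))

  sum-zero : ∀ {n} (f : Fin n → Elt) → (∀ i → f i ≡ 0#) → sum f ≡ 0#
  sum-zero {n} f h = trans (sum-cong-≗ h) (sum-replicate-zero n)

  minor : ∀ {m n} → Vec (Vec Elt (suc n)) m → Fin (suc n) → Vec (Vec Elt n) m
  minor R j = Vec.map (λ v → removeAt v j) R

  det-expand : ∀ n (x : Vec Elt (suc n)) (R : Vec (Vec Elt (suc n)) n) →
               det (suc n) (x ∷ R) ≡ sum (λ j → lookup x j * det n (minor R j))
  det-expand n x R = begin
    sumF (List.map f (allFin (suc n)))                 ≡⟨ cong sumF (Listₚ.map-tabulate id f) ⟩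
    sumF (List.tabulate f)                             ≡⟨ sumF-tabulate f ⟩
    sum f                                              ≡⟨ sum-cong-≗ (λ j → cong (_* det n (minor R j))
                                                            (trans (cong (_* lookup x j) (sign≡1 (Fin.toℕ j))) (*-identityˡ _))) ⟩
    sum (λ j → lookup x j * det n (minor R j))         ∎
    where
    f : Fin (suc n) → Elt
    f j = (sign (Fin.toℕ j) * lookup x j) * det n (minor R j)

  -- The Laplace expansion along two rows x and y: g j k stands for the complementary
  -- minor, k being an index into the columns left after deleting column j.  Symmetric
  -- says that g does not depend on the order in which two columns are deleted.
  twoRows : ∀ {n} → Vec Elt (suc n) → Vec Elt (suc n) → (Fin (suc n) → Fin n → Elt) → Elt
  twoRows x y g = sum (λ j → lookup x j * sum (λ k → lookup (removeAt y j) k * g j k))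

  Symmetric : ∀ n → (Fin (suc n) → Fin n → Elt) → Set
  Symmetric zero    g = ⊤
  Symmetric (suc n) g = (∀ k → g (suc k) zero ≡ g zero k) × Symmetric n (λ j k → g (suc j) (suc k))

  Symmetric-cong : ∀ n {g h} → (∀ j k → g j k ≡ h j k) → Symmetric n g → Symmetric n h
  Symmetric-cong zero    e _       = tt
  Symmetric-cong (suc n) e (s , t) =
    (λ k → trans (sym (e (suc k) zero)) (trans (s k) (e zero k))) , Symmetric-cong n (λ j k → e (suc j) (suc k)) t

  -- Sort the terms by the use of column 0: taken from `x`, taken from `y`, or from neither.
  -- `Symmetric` lets the first two kinds share the minors `g zero k`, so that exchanging the rows
  -- merely exchanges them.
  twoRows-step : ∀ {n} x₀ y₀ (x y : Vec Elt (suc n)) g → Symmetric (suc n) g →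
                 twoRows (x₀ ∷ x) (y₀ ∷ y) g ≡
                 (x₀ * sum (λ k → lookup y k * g zero k) + y₀ * sum (λ k → lookup x k * g zero k))
                 + twoRows x y (λ j k → g (suc j) (suc k))
  twoRows-step {n} x₀ y₀ x@(_ ∷ _) y@(_ ∷ _) g (s , _) = begin
    A + sum (λ j → lookup x j * (y₀ * g (suc j) zero + B j))
      ≡⟨ cong (A +_) (sum-cong-≗ (λ j → trans
           (solve 4 (λ a b c d → a :* (b :* c :+ d) := b :* (a :* c) :+ a :* d) refl (lookup x j) y₀ (g (suc j) zero) (B j))
           (cong (λ z → y₀ * (lookup x j * z) + lookup x j * B j) (s j)))) ⟩
    A + sum (λ j → y₀ * (lookup x j * g zero j) + lookup x j * B j)
      ≡⟨ cong (A +_) (∑-distrib-+ (λ j → y₀ * (lookup x j * g zero j)) (λ j → lookup x j * B j)) ⟩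
    A + (sum (λ j → y₀ * (lookup x j * g zero j)) + C)
      ≡⟨ cong (λ z → A + (z + C)) (*-distribˡ-sum y₀ (λ j → lookup x j * g zero j)) ⟨
    A + (y₀ * sum (λ j → lookup x j * g zero j) + C)
      ≡⟨ +-assoc A _ C ⟨
    (A + y₀ * sum (λ j → lookup x j * g zero j)) + C ∎
    where
    A = x₀ * sum (λ k → lookup y k * g zero k)
    B : Fin (suc n) → Elt
    B j = sum (λ k → lookup (removeAt y j) k * g (suc j) (suc k))
    C = twoRows x y (λ j k → g (suc j) (suc k))

  twoRows-single : ∀ (x y : Vec Elt 1) g → twoRows x y g ≡ 0#
  twoRows-single (x ∷ []) y g = trans (+-identityʳ _) (zeroʳ x)

  twoRows-swap : ∀ n (x y : Vec Elt (suc n)) g → Symmetric n g → twoRows x y g ≡ twoRows y x g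
  twoRows-swap zero    x y g s = trans (twoRows-single x y g) (sym (twoRows-single y x g))
  twoRows-swap (suc n) (x₀ ∷ x) (y₀ ∷ y) g s = begin
    twoRows (x₀ ∷ x) (y₀ ∷ y) g  ≡⟨ twoRows-step x₀ y₀ x y g s ⟩
    (A + B) + C                  ≡⟨ cong₂ _+_ (+-comm A B) (twoRows-swap n x y _ (proj₂ s)) ⟩
    (B + A) + D                  ≡⟨ twoRows-step y₀ x₀ y x g s ⟨
    twoRows (y₀ ∷ y) (x₀ ∷ x) g  ∎
    where
    A = x₀ * sum (λ k → lookup y k * g zero k)
    B = y₀ * sum (λ k → lookup x k * g zero k)
    C = twoRows x y (λ j k → g (suc j) (suc k))
    D = twoRows y x (λ j k → g (suc j) (suc k))

  -- Invariance under exchanging the rows says nothing about equal rows here. Instead the two kinds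
  -- of terms that use column 0 coincide and cancel, and induction disposes of the rest.
  twoRows-diagonal : ∀ n (x : Vec Elt (suc n)) g → Symmetric n g → twoRows x x g ≡ 0#
  twoRows-diagonal zero    x g s = twoRows-single x x g
  twoRows-diagonal (suc n) (x₀ ∷ x) g s = begin
    twoRows (x₀ ∷ x) (x₀ ∷ x) g  ≡⟨ twoRows-step x₀ x₀ x x g s ⟩
    (A + A) + C                  ≡⟨ cong₂ _+_ (x+x≡0 A) (twoRows-diagonal n x _ (proj₂ s)) ⟩
    0# + 0#                      ≡⟨ +-identityˡ 0# ⟩
    0#                           ∎
    where
    A = x₀ * sum (λ k → lookup x k * g zero k)
    C = twoRows x x (λ j k → g (suc j) (suc k))

  removeAt-head-comm : ∀ {n} (v : Vec Elt (suc (suc n))) k → removeAt (removeAt v (suc k)) zero ≡ removeAt (removeAt v zero) k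
  removeAt-head-comm (_ ∷ _ ∷ _) k = refl

  minor-head-comm : ∀ {m n} (R : Vec (Vec Elt (suc (suc n))) m) k → minor (minor R (suc k)) zero ≡ minor (minor R zero) k
  minor-head-comm []      k = refl
  minor-head-comm (v ∷ R) k = cong₂ _∷_ (removeAt-head-comm v k) (minor-head-comm R k)

  minor-∷ : ∀ {m n} (c : Vec Elt m) (R : Vec (Vec Elt (suc n)) m) j →
            minor (zipWith _∷_ c R) (suc j) ≡ zipWith _∷_ c (minor R j)
  minor-∷ []      []            j = refl
  minor-∷ (a ∷ c) ((_ ∷ _) ∷ R) j = cong (_ ∷_) (minor-∷ c R j)

  minor-∷-zero : ∀ {m n} (c : Vec Elt m) (R : Vec (Vec Elt n) m) → minor (zipWith _∷_ c R) zero ≡ R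
  minor-∷-zero []      []      = refl
  minor-∷-zero (a ∷ c) (v ∷ R) = cong (v ∷_) (minor-∷-zero c R)

  head-∷-tail : ∀ {m n} (R : Vec (Vec Elt (suc n)) m) → R ≡ zipWith _∷_ (Vec.map Vec.head R) (Vec.map Vec.tail R)
  head-∷-tail []            = refl
  head-∷-tail ((_ ∷ _) ∷ R) = cong (_ ∷_) (head-∷-tail R)

  -- Deleting two columns other than column 0 commutes with splitting column 0 off. The induction
  -- absorbs the split column into `h`, which is why `h` is arbitrary and not just a determinant.
  minors-symmetric : ∀ n {m} (R : Vec (Vec Elt (suc (suc n))) m) (h : Vec (Vec Elt n) m → Elt) →
                     Symmetric (suc n) (λ j k → h (minor (minor R j) k))
  minors-symmetric zero    R h = (λ k → cong h (minor-head-comm R k)) , tt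
  minors-symmetric (suc n) R h = (λ k → cong h (minor-head-comm R k)) ,
    Symmetric-cong (suc n) (λ j k → cong h (sym (begin
      minor (minor R (suc j)) (suc k)                      ≡⟨ cong (λ R → minor (minor R (suc j)) (suc k)) (head-∷-tail R) ⟩
      minor (minor (zipWith _∷_ c R′) (suc j)) (suc k)     ≡⟨ cong (λ R → minor R (suc k)) (minor-∷ c R′ j) ⟩
      minor (zipWith _∷_ c (minor R′ j)) (suc k)           ≡⟨ minor-∷ c (minor R′ j) k ⟩
      zipWith _∷_ c (minor (minor R′ j) k)                 ∎)))
      (minors-symmetric n R′ (h ∘ zipWith _∷_ c))
    where
    c  = Vec.map Vec.head R
    R′ = Vec.map Vec.tail R

  det-expand₂ : ∀ n x y (R : Vec (Vec Elt (suc (suc n))) n) →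
                det (suc (suc n)) (x ∷ y ∷ R) ≡ twoRows x y (λ j k → det n (minor (minor R j) k))
  det-expand₂ n x y R = trans (det-expand (suc n) x (y ∷ R))
    (sum-cong-≗ (λ j → cong (lookup x j *_) (det-expand n (removeAt y j) (minor R j))))

  det-swap : ∀ n x y (R : Vec (Vec Elt (suc (suc n))) n) → det (suc (suc n)) (x ∷ y ∷ R) ≡ det (suc (suc n)) (y ∷ x ∷ R)
  det-swap n x y R = begin
    det _ (x ∷ y ∷ R)  ≡⟨ det-expand₂ n x y R ⟩
    twoRows x y g      ≡⟨ twoRows-swap (suc n) x y g (minors-symmetric n R (det n)) ⟩
    twoRows y x g      ≡⟨ det-expand₂ n y x R ⟨
    det _ (y ∷ x ∷ R)  ∎
    where
    g : Fin (suc (suc n)) → Fin (suc n) → Elt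
    g j k = det n (minor (minor R j) k)

  -- When the copy is not the next row, exchange the top two rows and expand along `y`: each minor
  -- again begins with a row that recurs further down.
  det-repeated : ∀ n (R : Vec (Vec Elt (suc n)) n) i → det (suc n) (lookup R i ∷ R) ≡ 0#
  det-repeated (suc n) (x ∷ R) zero    = trans (det-expand₂ n x x R) 
    (twoRows-diagonal (suc n) x (λ j k → det n (minor (minor R j) k)) (minors-symmetric n R (det n)))
  det-repeated (suc n) (y ∷ R) (suc i) = begin
    det _ (x ∷ y ∷ R)                                            ≡⟨ det-swap n x y R ⟩
    det _ (y ∷ x ∷ R)                                            ≡⟨ det-expand (suc n) y (x ∷ R) ⟩
    sum (λ j → lookup y j * det (suc n) (removeAt x j ∷ minor R j))
      ≡⟨ sum-zero _ (λ j → trans (cong (lookup y j *_) (trans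
           (cong (λ v → det (suc n) (v ∷ minor R j)) (sym (Vecₚ.lookup-map i (λ v → removeAt v j) R)))
           (det-repeated n (minor R j) i))) (zeroʳ _)) ⟩
    0# ∎
    where x = lookup R i

  addmul : ∀ {n} → Vec Elt n → Elt → Vec Elt n → Vec Elt n
  addmul x t y = zipWith (λ a b → a + t * b) x y

  det-addmul : ∀ n x t y (R : Vec (Vec Elt (suc n)) n) →
               det (suc n) (addmul x t y ∷ R) ≡ det (suc n) (x ∷ R) + t * det (suc n) (y ∷ R)
  det-addmul n x t y R = begin
    det _ (addmul x t y ∷ R)                                     ≡⟨ det-expand n (addmul x t y) R ⟩
    sum (λ j → lookup (addmul x t y) j * m j)
      ≡⟨ sum-cong-≗ (λ j → trans (cong (_* m j) (Vecₚ.lookup-zipWith (λ a b → a + t * b) j x y))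
           (solve 4 (λ a t b m → (a :+ t :* b) :* m := a :* m :+ t :* (b :* m)) refl (lookup x j) t (lookup y j) (m j))) ⟩
    sum (λ j → lookup x j * m j + t * (lookup y j * m j))        ≡⟨ ∑-distrib-+ (λ j → lookup x j * m j) (λ j → t * (lookup y j * m j)) ⟩
    sum (λ j → lookup x j * m j) + sum (λ j → t * (lookup y j * m j))
      ≡⟨ cong₂ _+_ (det-expand n x R) (trans (cong (t *_) (det-expand n y R)) (*-distribˡ-sum t (λ j → lookup y j * m j))) ⟨
    det _ (x ∷ R) + t * det _ (y ∷ R)                            ∎
    where
    m : Fin (suc n) → Elt
    m j = det n (minor R j)

  det-shift : ∀ n x t (R : Vec (Vec Elt (suc n)) n) i → det (suc n) (addmul x t (lookup R i) ∷ R) ≡ det (suc n) (x ∷ R)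
  det-shift n x t R i = begin
    det _ (addmul x t (lookup R i) ∷ R)          ≡⟨ det-addmul n x t (lookup R i) R ⟩
    det _ (x ∷ R) + t * det _ (lookup R i ∷ R)   ≡⟨ cong (λ z → det _ (x ∷ R) + t * z) (det-repeated n R i) ⟩
    det _ (x ∷ R) + t * 0#                       ≡⟨ cong (det _ (x ∷ R) +_) (zeroʳ t) ⟩
    det _ (x ∷ R) + 0#                           ≡⟨ +-identityʳ _ ⟩
    det _ (x ∷ R)                                ∎

  addRows : ∀ {m n} → Vec Elt m → Vec Elt n → Vec (Vec Elt n) m → Vec (Vec Elt n) m
  addRows ts x R = zipWith (λ t v → addmul v t x) ts R

  removeAt-addmul : ∀ {n} (v : Vec Elt (suc n)) t x j → removeAt (addmul v t x) j ≡ addmul (removeAt v j) t (removeAt x j)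
  removeAt-addmul (_ ∷ v)         t (_ ∷ x)         zero    = refl
  removeAt-addmul (_ ∷ v@(_ ∷ _)) t (_ ∷ x@(_ ∷ _)) (suc j) = cong (_ ∷_) (removeAt-addmul v t x j)

  minor-addRows : ∀ {m n} ts (x : Vec Elt (suc n)) (R : Vec (Vec Elt (suc n)) m) j →
                  minor (addRows ts x R) j ≡ addRows ts (removeAt x j) (minor R j)
  minor-addRows []       x []      j = refl
  minor-addRows (t ∷ ts) x (v ∷ R) j = cong₂ _∷_ (removeAt-addmul v t x j) (minor-addRows ts x R j)

  -- An exchange brings the first altered row to the top, where `det-shift` undoes its alteration.
  -- Expanding along the restored row `y` passes the remaining alterations to the minors, where
  -- induction applies.
  det-addRows : ∀ n x ts (R : Vec (Vec Elt (suc n)) n) → det (suc n) (x ∷ addRows ts x R) ≡ det (suc n) (x ∷ R)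
  det-addRows zero    x []       []      = refl
  det-addRows (suc n) x (t ∷ ts) (y ∷ R) = begin
    det _ (x ∷ addmul y t x ∷ R′)   ≡⟨ det-swap n x (addmul y t x) R′ ⟩
    det _ (addmul y t x ∷ x ∷ R′)   ≡⟨ det-shift (suc n) y t (x ∷ R′) zero ⟩
    det _ (y ∷ x ∷ R′)              ≡⟨ det-expand (suc n) y (x ∷ R′) ⟩
    sum (λ j → lookup y j * det (suc n) (removeAt x j ∷ minor R′ j))
      ≡⟨ sum-cong-≗ (λ j → cong (lookup y j *_) (trans
           (cong (λ M → det (suc n) (removeAt x j ∷ M)) (minor-addRows ts x R j))
           (det-addRows n (removeAt x j) ts (minor R j)))) ⟩
    sum (λ j → lookup y j * det (suc n) (removeAt x j ∷ minor R j))
      ≡⟨ det-expand (suc n) y (x ∷ R) ⟨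
    det _ (y ∷ x ∷ R)               ≡⟨ det-swap n y x R ⟩
    det _ (x ∷ y ∷ R)               ∎
    where R′ = addRows ts x R

  zeros : ∀ n → Vec Elt n
  zeros n = replicate n 0#

  -- Mutual induction with `det-block`: a zero first column is the block shape with corner 0, and in
  -- the block shape every minor away from the corner keeps a zero first column.
  det-zero-column : ∀ n (D : Vec (Vec Elt n) (suc n)) → det (suc n) (zipWith _∷_ (zeros (suc n)) D) ≡ 0#
  det-block : ∀ n a b (D : Vec (Vec Elt n) n) → det (suc n) ((a ∷ b) ∷ zipWith _∷_ (zeros n) D) ≡ a * det n D

  det-zero-column n (b ∷ D) = trans (det-block n 0# b D) (zeroˡ _)

  det-block n a b D = begin
    det _ ((a ∷ b) ∷ zipWith _∷_ (zeros n) D)   ≡⟨ det-expand n (a ∷ b) (zipWith _∷_ (zeros n) D) ⟩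
    a * det n (minor (zipWith _∷_ (zeros n) D) zero) + sum (λ j → lookup b j * det n (minor (zipWith _∷_ (zeros n) D) (suc j)))
                                                ≡⟨ cong₂ (λ M z → a * det n M + z) (minor-∷-zero (zeros n) D) (sum-zero _ (off-corner n b D)) ⟩
    a * det n D + 0#                            ≡⟨ +-identityʳ _ ⟩
    a * det n D                                 ∎
    where
    off-corner : ∀ n (b : Vec Elt n) (D : Vec (Vec Elt n) n) j → lookup b j * det n (minor (zipWith _∷_ (zeros n) D) (suc j)) ≡ 0#
    off-corner (suc n) b D j = trans (cong (lookup b j *_)
      (trans (cong (det (suc n)) (minor-∷ (zeros (suc n)) D j)) (det-zero-column n (minor D j)))) (zeroʳ _)

  matTrace-sum : ∀ n (M : Mat n) → matTrace n M ≡ sum (λ i → lookup (lookup M i) i)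
  matTrace-sum n M = trans (cong (sumF ∘ Vec.toList) (sym (Vecₚ.tabulate-∘ (λ i → lookup (lookup M i) i) id)))
    (go (λ i → lookup (lookup M i) i))
    where
    go : ∀ {n} (f : Fin n → Elt) → sumF (Vec.toList (Vec.tabulate f)) ≡ sum f
    go {zero}  f = refl
    go {suc n} f = cong (f zero +_) (go (f ∘ suc))

  matTrace-block : ∀ n a b c (D : Mat n) → matTrace (suc n) ((a ∷ b) ∷ zipWith _∷_ c D) ≡ a + matTrace n D
  matTrace-block n a b c D = begin
    matTrace (suc n) ((a ∷ b) ∷ zipWith _∷_ c D)                   ≡⟨ matTrace-sum (suc n) ((a ∷ b) ∷ zipWith _∷_ c D) ⟩
    a + sum (λ i → lookup (lookup (zipWith _∷_ c D) i) (suc i))    ≡⟨ cong (a +_) (sum-cong-≗ (λ i →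
                                                                        cong (λ v → lookup v (suc i)) (Vecₚ.lookup-zipWith _∷_ i c D))) ⟩
    a + sum (λ i → lookup (lookup D i) i)                          ≡⟨ cong (a +_) (matTrace-sum n D) ⟨
    a + matTrace n D                                               ∎

self-negative⇒0 : (x : ℤ) → x ≡ -[1+ 0 ] ℤ.* x → x ≡ pos 0
self-negative⇒0 (pos zero)    e = refl
self-negative⇒0 (pos (suc n)) ()
self-negative⇒0 -[1+ n ]      ()

pos-^-+ : ∀ q m n → pos (q ^ m) ℤ.* pos (q ^ n) ≡ pos (q ^ (m ℕ.+ n))
pos-^-+ q m n = trans (sym (ℤₚ.pos-* (q ^ m) (q ^ n))) (cong pos (sym (ℕₚ.^-distribˡ-+-* q m n)))

-- Passing from size n + 1 to n + 2 contributes a factor q^(n+1), both for the character sums and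
-- for the number of matrices; this identity collects the exponents.
[2+n]C2 : ∀ n → suc (suc n) C 2 ≡ suc n ℕ.+ (suc n C 2)
[2+n]C2 n = trans (sym (nCk+nC[k+1]≡[n+1]C[k+1] (suc n) 1)) (cong (ℕ._+ (suc n C 2)) (nC1≡n (suc n)))

-- Character sums over matrices of fixed determinant

module MatrixSums (r : ℕ) {q : ℕ} (q≡2^r : q ≡ 2 ^ r) (F : FiniteField q) where
  open FiniteField F renaming (_+_ to infixl 6 _+_; _*_ to infixl 7 _*_)
  open FieldDefs F
  open TwoPower r q≡2^r F public
  open Determinant r q≡2^r F public

  V : ∀ n → List (Vec Elt n)
  V = allVecs elements

  ∑-elements-const : ∀ c → ∑ elements (λ _ → c) ≡ pos q ℤ.* c
  ∑-elements-const c = trans (∑-const elements c) (cong (λ n → pos n ℤ.* c) (Listₚ.length-tabulate {n = q} id))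

  ∑-V-const : ∀ n c → ∑ (V n) (λ _ → c) ≡ pos (q ^ n) ℤ.* c
  ∑-V-const zero    c = trans (ℤₚ.+-identityʳ c) (sym (ℤₚ.*-identityˡ c))
  ∑-V-const (suc n) c = begin
    ∑ (V (suc n)) (λ _ → c)                       ≡⟨ ∑-allVecs elements n (λ _ → c) ⟩
    ∑ elements (λ _ → ∑ (V n) (λ _ → c))          ≡⟨ ∑-cong elements (λ _ → ∑-V-const n c) ⟩
    ∑ elements (λ _ → pos (q ^ n) ℤ.* c)          ≡⟨ ∑-elements-const _ ⟩
    pos q ℤ.* (pos (q ^ n) ℤ.* c)                 ≡⟨ ℤₚ.*-assoc (pos q) (pos (q ^ n)) c ⟨
    pos q ℤ.* pos (q ^ n) ℤ.* c                   ≡⟨ cong (ℤ._* c) (ℤₚ.pos-* q (q ^ n)) ⟨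
    pos (q ^ suc n) ℤ.* c                         ∎

  ∑-translate : ∀ c f → ∑ elements (λ x → f (x + c)) ≡ ∑ elements f
  ∑-translate c = ∑-Fin-permute (_+ c) (_+ c) (λ x → [x+y]+y≡x x c) (λ x → [x+y]+y≡x x c)

  ∑-addmul : ∀ {n} t (w : Vec Elt n) f → ∑ (V n) (λ v → f (addmul v t w)) ≡ ∑ (V n) f
  ∑-addmul t []      f = refl
  ∑-addmul t (a ∷ w) f = begin
    ∑ (V _) (λ v → f (addmul v t (a ∷ w)))                             ≡⟨ ∑-allVecs elements _ _ ⟩
    ∑ elements (λ x → ∑ (V _) (λ v → f ((x + t * a) ∷ addmul v t w)))  ≡⟨ ∑-cong elements (λ x → ∑-addmul t w (λ v → f ((x + t * a) ∷ v))) ⟩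
    ∑ elements (λ x → ∑ (V _) (λ v → f ((x + t * a) ∷ v)))             ≡⟨ ∑-translate (t * a) (λ x → ∑ (V _) (λ v → f (x ∷ v))) ⟩
    ∑ elements (λ x → ∑ (V _) (λ v → f (x ∷ v)))                       ≡⟨ ∑-allVecs elements _ f ⟨
    ∑ (V _) f                                                          ∎

  ∑-addRows : ∀ {m n} ts (x : Vec Elt n) f → ∑ (allVecs (V n) m) (λ R → f (addRows ts x R)) ≡ ∑ (allVecs (V n) m) f
  ∑-addRows         []       x f = refl
  ∑-addRows {n = n} (t ∷ ts) x f = begin
    ∑ (allVecs (V n) _) (λ R → f (addRows (t ∷ ts) x R))                                 ≡⟨ ∑-allVecs (V n) _ _ ⟩
    ∑ (V n) (λ v → ∑ (allVecs (V n) _) (λ R → f (addmul v t x ∷ addRows ts x R)))        ≡⟨ ∑-cong (V n) (λ v → ∑-addRows ts x (λ R → f (addmul v t x ∷ R))) ⟩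
    ∑ (V n) (λ v → ∑ (allVecs (V n) _) (λ R → f (addmul v t x ∷ R)))                     ≡⟨ ∑-addmul t x (λ v → ∑ (allVecs (V n) _) (λ R → f (v ∷ R))) ⟩
    ∑ (V n) (λ v → ∑ (allVecs (V n) _) (λ R → f (v ∷ R)))                                ≡⟨ ∑-allVecs (V n) _ f ⟨
    ∑ (allVecs (V n) _) f                                                                ∎

  ∑-columns : ∀ n m (f : Vec (Vec Elt (suc n)) m → ℤ) →
              ∑ (allVecs (V (suc n)) m) f ≡ ∑ (V m) (λ c → ∑ (allVecs (V n) m) (λ D → f (zipWith _∷_ c D)))
  ∑-columns n zero    f = sym (ℤₚ.+-identityʳ _)
  ∑-columns n (suc m) f = begin
    ∑ (allVecs (V (suc n)) (suc m)) f
      ≡⟨ ∑-allVecs (V (suc n)) m f ⟩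
    ∑ (V (suc n)) (λ v → ∑ (allVecs (V (suc n)) m) (λ R → f (v ∷ R)))
      ≡⟨ ∑-cong (V (suc n)) (λ v → ∑-columns n m (λ R → f (v ∷ R))) ⟩
    ∑ (V (suc n)) (λ v → ∑ (V m) (λ c → ∑ (allVecs (V n) m) (λ D → f (v ∷ zipWith _∷_ c D))))
      ≡⟨ ∑-allVecs elements n _ ⟩
    ∑ elements (λ a → ∑ (V n) (λ b → ∑ (V m) (λ c → ∑ (allVecs (V n) m) (λ D → f ((a ∷ b) ∷ zipWith _∷_ c D)))))
      ≡⟨ ∑-cong elements (λ a → ∑-swap (V n) (V m) _) ⟩
    ∑ elements (λ a → ∑ (V m) (λ c → ∑ (V n) (λ b → ∑ (allVecs (V n) m) (λ D → f ((a ∷ b) ∷ zipWith _∷_ c D)))))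
      ≡⟨ ∑-cong elements (λ a → ∑-cong (V m) (λ c → ∑-allVecs (V n) m (λ D → f (zipWith _∷_ (a ∷ c) D)))) ⟨
    ∑ elements (λ a → ∑ (V m) (λ c → ∑ (allVecs (V n) (suc m)) (λ D → f (zipWith _∷_ (a ∷ c) D))))
      ≡⟨ ∑-allVecs elements m (λ c → ∑ (allVecs (V n) (suc m)) (λ D → f (zipWith _∷_ c D))) ⟨
    ∑ (V (suc m)) (λ c → ∑ (allVecs (V n) (suc m)) (λ D → f (zipWith _∷_ c D))) ∎

  ∑-blocks : ∀ n (f : Mat (suc n) → ℤ) →
             ∑ (allMats (suc n)) f ≡ ∑ (V n) (λ c → ∑ (allMats n) (λ D → ∑ (V (suc n)) (λ x → f (x ∷ zipWith _∷_ c D))))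
  ∑-blocks n f = begin
    ∑ (allMats (suc n)) f                                                                     ≡⟨ ∑-allVecs (V (suc n)) n f ⟩
    ∑ (V (suc n)) (λ x → ∑ (allVecs (V (suc n)) n) (λ R → f (x ∷ R)))                         ≡⟨ ∑-swap (V (suc n)) (allVecs (V (suc n)) n) (λ x R → f (x ∷ R)) ⟩
    ∑ (allVecs (V (suc n)) n) (λ R → ∑ (V (suc n)) (λ x → f (x ∷ R)))                         ≡⟨ ∑-columns n n _ ⟩
    ∑ (V n) (λ c → ∑ (allMats n) (λ D → ∑ (V (suc n)) (λ x → f (x ∷ zipWith _∷_ c D))))       ∎

  -- A nonzero vector is presented together with the position of a nonzero entry, because the
  -- applications need that entry as a pivot.
  ∑-supported-at-zero : ∀ n (f : Vec Elt n → ℤ) → (∀ v i → lookup v i ≢ 0# → f v ≡ pos 0) → ∑ (V n) f ≡ f (zeros n)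
  ∑-supported-at-zero zero    f h = ℤₚ.+-identityʳ _
  ∑-supported-at-zero (suc n) f h = begin
    ∑ (V (suc n)) f                               ≡⟨ ∑-allVecs elements n f ⟩
    ∑ elements (λ x → ∑ (V n) (λ v → f (x ∷ v)))  ≡⟨ ∑-Fin-single 0# _ (λ x x≢0 → trans (∑-cong (V n) (λ v → h (x ∷ v) zero x≢0)) (∑-zero (V n))) ⟩
    ∑ (V n) (λ v → f (0# ∷ v))                    ≡⟨ ∑-supported-at-zero n (λ v → f (0# ∷ v)) (λ v i → h (0# ∷ v) (suc i)) ⟩
    f (zeros (suc n))                             ∎

  ∑-constant-off-zero : ∀ n (f : Vec Elt n → ℤ) w → (∀ v i → lookup v i ≢ 0# → f v ≡ w) → f (zeros n) ≡ pos 0 →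
                        ∑ (V n) f ≡ (pos (q ^ n) ℤ.- pos 1) ℤ.* w
  ∑-constant-off-zero n f w h f0 = begin
    ∑ (V n) f                                           ≡⟨ ∑-cong (V n) (λ v → lem₁ (f v) w) ⟩
    ∑ (V n) (λ v → (f v ℤ.- w) ℤ.+ w)                   ≡⟨ ∑-+ (V n) (λ v → f v ℤ.- w) (λ _ → w) ⟩
    ∑ (V n) (λ v → f v ℤ.- w) ℤ.+ ∑ (V n) (λ _ → w)     ≡⟨ cong₂ ℤ._+_ (∑-supported-at-zero n (λ v → f v ℤ.- w)
                                                             (λ v i v≢0 → trans (cong (ℤ._- w) (h v i v≢0)) (ℤₚ.+-inverseʳ w))) (∑-V-const n w) ⟩
    (f (zeros n) ℤ.- w) ℤ.+ pos (q ^ n) ℤ.* w           ≡⟨ cong (λ z → (z ℤ.- w) ℤ.+ pos (q ^ n) ℤ.* w) f0 ⟩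
    (pos 0 ℤ.- w) ℤ.+ pos (q ^ n) ℤ.* w                 ≡⟨ lem₂ (pos (q ^ n)) w ⟩
    (pos (q ^ n) ℤ.- pos 1) ℤ.* w                       ∎
    where
    lem₁ : ∀ a b → a ≡ (a ℤ.- b) ℤ.+ b
    lem₁ = ℤSolver.solve-∀
    lem₂ : ∀ a b → (pos 0 ℤ.- b) ℤ.+ a ℤ.* b ≡ (a ℤ.- pos 1) ℤ.* b
    lem₂ = ℤSolver.solve-∀

  ∑-nonzero : ∀ f → ∑ elements f ≡ f 0# ℤ.+ ∑ nonzero f
  ∑-nonzero f = begin
    ∑ elements f
      ≡⟨ ∑-cong elements split ⟩
    ∑ elements (λ x → 𝟙 (x ≟F 0#) ℤ.* f x ℤ.+ 𝟙 (¬? (x ≟F 0#)) ℤ.* f x)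
      ≡⟨ ∑-+ elements _ _ ⟩
    ∑ elements (λ x → 𝟙 (x ≟F 0#) ℤ.* f x) ℤ.+ ∑ elements (λ x → 𝟙 (¬? (x ≟F 0#)) ℤ.* f x)
      ≡⟨ cong₂ ℤ._+_ (∑-Fin-pick 0# f) (sym (∑-filter (λ x → ¬? (x ≟F 0#)) elements f)) ⟩
    f 0# ℤ.+ ∑ nonzero f ∎
    where
    split : ∀ x → f x ≡ 𝟙 (x ≟F 0#) ℤ.* f x ℤ.+ 𝟙 (¬? (x ≟F 0#)) ℤ.* f x
    split x with does (x ≟F 0#)
    ... | true  = sym (trans (ℤₚ.+-identityʳ _) (ℤₚ.*-identityˡ (f x)))
    ... | false = sym (trans (ℤₚ.+-identityˡ _) (ℤₚ.*-identityˡ (f x)))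

  ∑-nonzero-vanishing : ∀ f → f 0# ≡ pos 0 → ∑ elements f ≡ ∑ nonzero f
  ∑-nonzero-vanishing f f0 = trans (∑-nonzero f) (trans (cong (ℤ._+ ∑ nonzero f) f0) (ℤₚ.+-identityˡ _))

  ∑-nonzero-minus : ∀ f → ∑ nonzero f ≡ ∑ elements f ℤ.- f 0#
  ∑-nonzero-minus f = trans (lem (f 0#) (∑ nonzero f)) (cong (ℤ._- f 0#) (sym (∑-nonzero f)))
    where
    lem : ∀ a b → b ≡ (a ℤ.+ b) ℤ.- a
    lem = ℤSolver.solve-∀

  ∑-nonzero-cong : ∀ {f g : Elt → ℤ} → (∀ x → x ≢ 0# → f x ≡ g x) → ∑ nonzero f ≡ ∑ nonzero g
  ∑-nonzero-cong = ∑-filter-cong (λ x → ¬? (x ≟F 0#)) elements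

  𝟙-divide : ∀ {a} → a ≢ 0# → ∀ x d → 𝟙 ((a * x) ≟F d) ≡ 𝟙 (x ≟F (d * (a ⁻¹)))
  𝟙-divide {a} a≢0 x d = 𝟙-⇔ ((a * x) ≟F d) (x ≟F (d * (a ⁻¹)))
    (λ e → begin
      x                 ≡⟨ *-cancel-inverseˡ a x a≢0 ⟨
      (a ⁻¹) * (a * x)  ≡⟨ *-comm (a ⁻¹) (a * x) ⟩
      (a * x) * (a ⁻¹)  ≡⟨ cong (_* (a ⁻¹)) e ⟩
      d * (a ⁻¹)        ∎)
    (λ e → begin
      a * x             ≡⟨ cong (a *_) (trans e (*-comm d (a ⁻¹))) ⟩
      a * ((a ⁻¹) * d)  ≡⟨ *-cancel-inverseʳ a d a≢0 ⟩
      d                 ∎)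

  -- On a group of exponent 2 a character takes only the values 1 and -1, so integer values suffice
  -- and nontriviality is witnessed by a `τ` of value -1. The record covers λ and all its twists x ↦
  -- λ(ux) with u ≠ 0.
  record Character (φ : Elt → ℤ) : Set where
    field
      φ-+ : ∀ x y → φ (x + y) ≡ φ x ℤ.* φ y
      φ-0 : φ 0# ≡ pos 1
      τ   : Elt
      φ-τ : φ τ ≡ -[1+ 0 ]

  -- K_m for any φ, where `s` accumulates the variables and `x` is the argument divided by them so
  -- far. `klAux` carries the product of the variables instead; the quotient reproduces the
  -- recursion d ↦ d/a of the matrix sums.
  Kl : (Elt → ℤ) → ℕ → Elt → Elt → ℤ
  Kl φ zero    s x = φ (s + x)
  Kl φ (suc m) s x = ∑ nonzero (λ α → Kl φ m (s + α) (x * (α ⁻¹)))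

  module _ {φ : Elt → ℤ} (χ : Character φ) where
    open Character χ

    Kl-translate : ∀ m s x → Kl φ m s x ≡ φ s ℤ.* Kl φ m 0# x
    Kl-translate zero    s x = trans (φ-+ s x) (ℤ*-congˡ (φ s) (cong φ (sym (+-identityˡ x))))
    Kl-translate (suc m) s x = begin
      ∑ nonzero (λ α → Kl φ m (s + α) (x * (α ⁻¹)))
        ≡⟨ ∑-cong nonzero (λ α → trans (Kl-translate m (s + α) (x * (α ⁻¹))) (trans (cong (ℤ._* k α) (φ-+ s α)) (ℤₚ.*-assoc (φ s) (φ α) (k α)))) ⟩
      ∑ nonzero (λ α → φ s ℤ.* (φ α ℤ.* k α))
        ≡⟨ ∑-*ˡ (φ s) nonzero (λ α → φ α ℤ.* k α) ⟩
      φ s ℤ.* ∑ nonzero (λ α → φ α ℤ.* k α)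
        ≡⟨ ℤ*-congˡ (φ s) (∑-cong nonzero (λ α → trans (Kl-translate m (0# + α) (x * (α ⁻¹))) (cong (λ z → φ z ℤ.* k α) (+-identityˡ α)))) ⟨
      φ s ℤ.* ∑ nonzero (λ α → Kl φ m (0# + α) (x * (α ⁻¹))) ∎
      where
      k : Elt → ℤ
      k α = Kl φ m 0# (x * (α ⁻¹))

    ∑-character : ∑ elements φ ≡ pos 0
    ∑-character = self-negative⇒0 (∑ elements φ) (begin
      ∑ elements φ                            ≡⟨ ∑-translate τ φ ⟨
      ∑ elements (λ x → φ (x + τ))            ≡⟨ ∑-cong elements (λ x → trans (φ-+ x τ) (trans (ℤ*-congˡ (φ x) φ-τ) (ℤₚ.*-comm (φ x) -[1+ 0 ]))) ⟩
      ∑ elements (λ x → -[1+ 0 ] ℤ.* φ x)     ≡⟨ ∑-*ˡ -[1+ 0 ] elements φ ⟩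
      -[1+ 0 ] ℤ.* ∑ elements φ               ∎)

    ∑-nonzero-character : ∑ nonzero φ ≡ -[1+ 0 ]
    ∑-nonzero-character = trans (∑-nonzero-minus φ) (cong₂ ℤ._-_ ∑-character φ-0)

    gaussTerm : ∀ n → Elt → Mat n → ℤ
    gaussTerm n d M = 𝟙 (det n M ≟F d) ℤ.* φ (matTrace n M)

    gaussSum : ∀ n → Elt → ℤ
    gaussSum n d = ∑ (allMats n) (gaussTerm n d)

    -- Adding multiples of row i + 1 to row 0 fixes the determinant and, when the
    -- first column has a nonzero entry there, moves the trace through all of F.
    gaussSum-cancel : ∀ n d c (D : Mat n) i → lookup c i ≢ 0# →
                      ∑ (V (suc n)) (λ x → gaussTerm (suc n) d (x ∷ zipWith _∷_ c D)) ≡ pos 0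
    gaussSum-cancel n d c D i c≢0 = self-negative⇒0 _ (begin
      ∑ (V (suc n)) h                             ≡⟨ ∑-addmul t (lookup R i) h ⟨
      ∑ (V (suc n)) (λ x → h (addmul x t (lookup R i))) ≡⟨ ∑-cong (V (suc n)) shifted ⟩
      ∑ (V (suc n)) (λ x → -[1+ 0 ] ℤ.* h x)      ≡⟨ ∑-*ˡ -[1+ 0 ] (V (suc n)) h ⟩
      -[1+ 0 ] ℤ.* ∑ (V (suc n)) h                ∎)
      where
      R = zipWith _∷_ c D
      -- Chosen so that the corner, and with it the trace, moves by exactly `τ`. This one shift
      -- multiplies each term by -1, so the sum equals its own negative.
      t = (lookup c i ⁻¹) * τ
      h : Vec Elt (suc n) → ℤ
      h x = gaussTerm (suc n) d (x ∷ R)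
      trace-shifted : ∀ x → matTrace (suc n) (addmul x t (lookup R i) ∷ R) ≡ matTrace (suc n) (x ∷ R) + τ
      trace-shifted (a ∷ b) = begin
        matTrace (suc n) (addmul (a ∷ b) t (lookup R i) ∷ R)
          ≡⟨ cong (λ v → matTrace (suc n) (addmul (a ∷ b) t v ∷ R)) (Vecₚ.lookup-zipWith _∷_ i c D) ⟩
        matTrace (suc n) (((a + t * lookup c i) ∷ addmul b t (lookup D i)) ∷ R)
          ≡⟨ matTrace-block n (a + t * lookup c i) _ c D ⟩
        (a + t * lookup c i) + matTrace n D
          ≡⟨ cong (λ z → (a + z) + matTrace n D) (trans (*-comm t (lookup c i)) (*-cancel-inverseʳ (lookup c i) τ c≢0)) ⟩
        (a + τ) + matTrace n D
          ≡⟨ trans (+-assoc a τ _) (trans (cong (a +_) (+-comm τ _)) (sym (+-assoc a _ τ))) ⟩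
        (a + matTrace n D) + τ
          ≡⟨ cong (_+ τ) (matTrace-block n a b c D) ⟨
        matTrace (suc n) ((a ∷ b) ∷ R) + τ ∎
      neg : ∀ a b → a ℤ.* (b ℤ.* -[1+ 0 ]) ≡ -[1+ 0 ] ℤ.* (a ℤ.* b)
      neg = ℤSolver.solve-∀
      shifted : ∀ x → h (addmul x t (lookup R i)) ≡ -[1+ 0 ] ℤ.* h x
      shifted x = trans
        (cong₂ (λ u v → 𝟙 (u ≟F d) ℤ.* v) (det-shift n x t R i)
          (trans (cong φ (trace-shifted x)) (trans (φ-+ _ τ) (ℤ*-congˡ (φ (matTrace (suc n) (x ∷ R))) φ-τ))))
        (neg (𝟙 (det (suc n) (x ∷ R) ≟F d)) (φ (matTrace (suc n) (x ∷ R))))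

    -- Once the column below the corner `a` is zero, the rest `b` of the first row affects neither
    -- determinant nor trace and accounts for q^n; the corner a = 0 drops out because d ≠ 0.
    gaussSum-rec : ∀ n d → d ≢ 0# → gaussSum (suc n) d ≡ pos (q ^ n) ℤ.* ∑ nonzero (λ a → φ a ℤ.* gaussSum n (d * (a ⁻¹)))
    gaussSum-rec n d d≢0 = begin
      gaussSum (suc n) d
        ≡⟨ ∑-blocks n (gaussTerm (suc n) d) ⟩
      ∑ (V n) (λ c → ∑ (allMats n) (λ D → ∑ (V (suc n)) (λ x → gaussTerm (suc n) d (x ∷ zipWith _∷_ c D))))
        ≡⟨ ∑-supported-at-zero n _ (λ c i c≢0 → trans (∑-cong (allMats n) (λ D → gaussSum-cancel n d c D i c≢0)) (∑-zero (allMats n))) ⟩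
      ∑ (allMats n) (λ D → ∑ (V (suc n)) (λ x → gaussTerm (suc n) d (x ∷ zipWith _∷_ (zeros n) D)))
        ≡⟨ ∑-cong (allMats n) (λ D → ∑-allVecs elements n _) ⟩
      ∑ (allMats n) (λ D → ∑ elements (λ a → ∑ (V n) (λ b → gaussTerm (suc n) d ((a ∷ b) ∷ zipWith _∷_ (zeros n) D))))
        ≡⟨ ∑-cong (allMats n) (λ D → ∑-cong elements (λ a → trans (∑-cong (V n) (λ b → block a b D)) (∑-V-const n _))) ⟩
      ∑ (allMats n) (λ D → ∑ elements (λ a → Q ℤ.* (φ a ℤ.* f a D)))
        ≡⟨ ∑-swap (allMats n) elements _ ⟩
      ∑ elements (λ a → ∑ (allMats n) (λ D → Q ℤ.* (φ a ℤ.* f a D)))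
        ≡⟨ ∑-cong elements (λ a → trans (∑-*ˡ Q (allMats n) (λ D → φ a ℤ.* f a D)) (ℤ*-congˡ Q (∑-*ˡ (φ a) (allMats n) (f a)))) ⟩
      ∑ elements (λ a → Q ℤ.* (φ a ℤ.* ∑ (allMats n) (f a)))
        ≡⟨ ∑-*ˡ Q elements _ ⟩
      Q ℤ.* ∑ elements (λ a → φ a ℤ.* ∑ (allMats n) (f a))
        ≡⟨ ℤ*-congˡ Q (∑-nonzero-vanishing _ (trans (ℤ*-congˡ (φ 0#) (trans (∑-cong (allMats n) f0) (∑-zero (allMats n)))) (ℤₚ.*-zeroʳ (φ 0#)))) ⟩
      Q ℤ.* ∑ nonzero (λ a → φ a ℤ.* ∑ (allMats n) (f a))
        ≡⟨ ℤ*-congˡ Q (∑-nonzero-cong (λ a a≢0 → ℤ*-congˡ (φ a) (∑-cong (allMats n) (λ D →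
             cong (ℤ._* φ (matTrace n D)) (𝟙-divide a≢0 (det n D) d))))) ⟩
      Q ℤ.* ∑ nonzero (λ a → φ a ℤ.* gaussSum n (d * (a ⁻¹))) ∎
      where
      Q = pos (q ^ n)
      f : Elt → Mat n → ℤ
      f a D = 𝟙 ((a * det n D) ≟F d) ℤ.* φ (matTrace n D)
      block : ∀ a b D → gaussTerm (suc n) d ((a ∷ b) ∷ zipWith _∷_ (zeros n) D) ≡ φ a ℤ.* f a D
      block a b D = trans
        (cong₂ (λ u v → 𝟙 (u ≟F d) ℤ.* v) (det-block n a b D) (trans (cong φ (matTrace-block n a b (zeros n) D)) (φ-+ a _)))
        (ℤ*-leftComm (𝟙 ((a * det n D) ≟F d)) (φ a) (φ (matTrace n D)))
      f0 : ∀ D → f 0# D ≡ pos 0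
      f0 D = cong (ℤ._* φ (matTrace n D)) (𝟙-no ((0# * det n D) ≟F d) (λ e → d≢0 (trans (sym e) (zeroˡ _))))

    gaussSum-Kl : ∀ n d → d ≢ 0# → gaussSum (suc n) d ≡ pos (q ^ (suc n C 2)) ℤ.* Kl φ n 0# d
    gaussSum-Kl zero d d≢0 = begin
      gaussSum 1 d
        ≡⟨ gaussSum-rec 0 d d≢0 ⟩
      pos 1 ℤ.* ∑ nonzero (λ a → φ a ℤ.* gaussSum 0 (d * (a ⁻¹)))
        ≡⟨ ℤ*-congˡ (pos 1) (∑-nonzero-cong term) ⟩
      pos 1 ℤ.* ∑ nonzero (λ a → 𝟙 (a ≟F d) ℤ.* φ a)
        ≡⟨ ℤ*-congˡ (pos 1) (∑-nonzero-vanishing (λ a → 𝟙 (a ≟F d) ℤ.* φ a) (cong (ℤ._* φ 0#) (𝟙-no (0# ≟F d) (d≢0 ∘ sym)))) ⟨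
      pos 1 ℤ.* ∑ elements (λ a → 𝟙 (a ≟F d) ℤ.* φ a)
        ≡⟨ ℤ*-congˡ (pos 1) (trans (∑-Fin-pick d φ) (cong φ (sym (+-identityˡ d)))) ⟩
      pos 1 ℤ.* φ (0# + d) ∎
      where
      -- The only matrix of size 0 has determinant 1 and trace 0, so of all corners only a = d
      -- contributes.
      term : ∀ a → a ≢ 0# → φ a ℤ.* gaussSum 0 (d * (a ⁻¹)) ≡ 𝟙 (a ≟F d) ℤ.* φ a
      term a a≢0 = trans (ℤ*-congˡ (φ a) (begin
        𝟙 (1# ≟F (d * (a ⁻¹))) ℤ.* φ 0# ℤ.+ pos 0  ≡⟨ ℤₚ.+-identityʳ _ ⟩
        𝟙 (1# ≟F (d * (a ⁻¹))) ℤ.* φ 0#            ≡⟨ cong₂ ℤ._*_ (sym (𝟙-divide a≢0 1# d)) φ-0 ⟩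
        𝟙 ((a * 1#) ≟F d) ℤ.* pos 1                ≡⟨ ℤₚ.*-identityʳ _ ⟩
        𝟙 ((a * 1#) ≟F d)                          ≡⟨ cong (λ z → 𝟙 (z ≟F d)) (*-identityʳ a) ⟩
        𝟙 (a ≟F d)                                 ∎)) (ℤₚ.*-comm (φ a) (𝟙 (a ≟F d)))
    gaussSum-Kl (suc n) d d≢0 = begin
      gaussSum (suc (suc n)) d
        ≡⟨ gaussSum-rec (suc n) d d≢0 ⟩
      Q ℤ.* ∑ nonzero (λ a → φ a ℤ.* gaussSum (suc n) (d * (a ⁻¹)))
        ≡⟨ ℤ*-congˡ Q (∑-nonzero-cong (λ a a≢0 → trans
             (ℤ*-congˡ (φ a) (gaussSum-Kl n (d * (a ⁻¹)) (*-nonzero d≢0 (⁻¹-nonzero a≢0))))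
             (trans (ℤ*-leftComm (φ a) Q′ (Kl φ n 0# (d * (a ⁻¹))))
               (ℤ*-congˡ Q′ (trans (cong (λ z → φ z ℤ.* Kl φ n 0# (d * (a ⁻¹))) (sym (+-identityˡ a)))
                 (sym (Kl-translate n (0# + a) (d * (a ⁻¹))))))))) ⟩
      Q ℤ.* ∑ nonzero (λ a → Q′ ℤ.* Kl φ n (0# + a) (d * (a ⁻¹)))
        ≡⟨ ℤ*-congˡ Q (∑-*ˡ Q′ nonzero (λ a → Kl φ n (0# + a) (d * (a ⁻¹)))) ⟩
      Q ℤ.* (Q′ ℤ.* Kl φ (suc n) 0# d)
        ≡⟨ ℤₚ.*-assoc Q Q′ _ ⟨
      Q ℤ.* Q′ ℤ.* Kl φ (suc n) 0# d
        ≡⟨ cong (ℤ._* Kl φ (suc n) 0# d) (trans (pos-^-+ q (suc n) (suc n C 2)) (cong (λ e → pos (q ^ e)) (sym ([2+n]C2 n)))) ⟩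
      pos (q ^ (suc (suc n) C 2)) ℤ.* Kl φ (suc n) 0# d ∎
      where
      Q = pos (q ^ suc n)
      Q′ = pos (q ^ (suc n C 2))

-- Number of matrices with a given nonzero determinant

module Counting (r : ℕ) {q : ℕ} (q≡2^r : q ≡ 2 ^ r) (F : FiniteField q) where
  open FiniteField F renaming (_+_ to infixl 6 _+_; _*_ to infixl 7 _*_)
  open FieldDefs F
  open MatrixSums r q≡2^r F public
  open Solver using (solve; _:+_; _:*_; _:=_)

  detCount : ∀ n → Elt → ℤ
  detCount n d = ∑ (allMats n) (λ M → 𝟙 (det n M ≟F d))

  columnCount : ∀ n → Elt → Vec Elt (suc n) → ℤ
  columnCount n d (a ∷ c) = ∑ (V n) (λ b → ∑ (allMats n) (λ D → 𝟙 (det (suc n) ((a ∷ b) ∷ zipWith _∷_ c D) ≟F d)))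

  detCount-columns : ∀ n d → detCount (suc n) d ≡ ∑ (V (suc n)) (columnCount n d)
  detCount-columns n d = begin
    ∑ (allMats (suc n)) (λ M → 𝟙 (det (suc n) M ≟F d))
      ≡⟨ ∑-blocks n (λ M → 𝟙 (det (suc n) M ≟F d)) ⟩
    ∑ (V n) (λ c → ∑ (allMats n) (λ D → ∑ (V (suc n)) (λ x → 𝟙 (det (suc n) (x ∷ zipWith _∷_ c D) ≟F d))))
      ≡⟨ ∑-cong (V n) (λ c → ∑-cong (allMats n) (λ D → ∑-allVecs elements n (λ x → 𝟙 (det (suc n) (x ∷ zipWith _∷_ c D) ≟F d)))) ⟩
    ∑ (V n) (λ c → ∑ (allMats n) (λ D → ∑ elements (λ a → ∑ (V n) (λ b → g a b c D))))
      ≡⟨ ∑-cong (V n) (λ c → ∑-swap (allMats n) elements (λ D a → ∑ (V n) (λ b → g a b c D))) ⟩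
    ∑ (V n) (λ c → ∑ elements (λ a → ∑ (allMats n) (λ D → ∑ (V n) (λ b → g a b c D))))
      ≡⟨ ∑-cong (V n) (λ c → ∑-cong elements (λ a → ∑-swap (allMats n) (V n) (λ D b → g a b c D))) ⟩
    ∑ (V n) (λ c → ∑ elements (λ a → columnCount n d (a ∷ c)))
      ≡⟨ ∑-swap (V n) elements (λ c a → columnCount n d (a ∷ c)) ⟩
    ∑ elements (λ a → ∑ (V n) (λ c → columnCount n d (a ∷ c)))
      ≡⟨ ∑-allVecs elements n (columnCount n d) ⟨
    ∑ (V (suc n)) (columnCount n d) ∎
    where
    g : Elt → Vec Elt n → Vec Elt n → Mat n → ℤ
    g a b c D = 𝟙 (det (suc n) ((a ∷ b) ∷ zipWith _∷_ c D) ≟F d)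

  clear-column : ∀ {m n} a → a ≢ 0# → (b : Vec Elt n) (c : Vec Elt m) (D : Vec (Vec Elt n) m) →
                 zipWith _∷_ c (addRows (Vec.map (_* (a ⁻¹)) c) b D) ≡
                 addRows (Vec.map (_* (a ⁻¹)) c) (a ∷ b) (zipWith _∷_ (zeros m) D)
  clear-column a a≢0 b []      []      = refl
  clear-column a a≢0 b (x ∷ c) (v ∷ D) = cong₂ _∷_ (cong (_∷ addmul v (x * (a ⁻¹)) b) (sym (begin
    0# + (x * (a ⁻¹)) * a    ≡⟨ +-identityˡ _ ⟩
    (x * (a ⁻¹)) * a         ≡⟨ *-assoc x (a ⁻¹) a ⟩
    x * ((a ⁻¹) * a)         ≡⟨ cong (x *_) (inverseˡ a a≢0) ⟩
    x * 1#                   ≡⟨ *-identityʳ x ⟩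
    x                        ∎))) (clear-column a a≢0 b c D)

  module _ (n : ℕ) (P : ℤ) (uniform : ∀ e → e ≢ 0# → detCount n e ≡ P) (d : Elt) (d≢0 : d ≢ 0#) where

    -- For fixed `a`, `b`, `c`, adding (c_i / a) b to row i of `D` is a bijection, after which the
    -- matrix arises from the block shape by adding multiples of the first row. What remains is det
    -- D = d/a, so the induction hypothesis has to cover every nonzero determinant.
    columnCount-pivot : ∀ a c → a ≢ 0# → columnCount n d (a ∷ c) ≡ pos (q ^ n) ℤ.* P
    columnCount-pivot a c a≢0 = trans (∑-cong (V n) inner) (∑-V-const n P)
      where
      ts = Vec.map (_* (a ⁻¹)) c
      inner : ∀ b → ∑ (allMats n) (λ D → 𝟙 (det (suc n) ((a ∷ b) ∷ zipWith _∷_ c D) ≟F d)) ≡ P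
      inner b = begin
        ∑ (allMats n) (λ D → 𝟙 (det (suc n) ((a ∷ b) ∷ zipWith _∷_ c D) ≟F d))
          ≡⟨ ∑-addRows ts b (λ D → 𝟙 (det (suc n) ((a ∷ b) ∷ zipWith _∷_ c D) ≟F d)) ⟨
        ∑ (allMats n) (λ D → 𝟙 (det (suc n) ((a ∷ b) ∷ zipWith _∷_ c (addRows ts b D)) ≟F d))
          ≡⟨ ∑-cong (allMats n) (λ D → trans (cong (λ z → 𝟙 (z ≟F d)) (begin
               det (suc n) ((a ∷ b) ∷ zipWith _∷_ c (addRows ts b D))                       ≡⟨ cong (λ R → det (suc n) ((a ∷ b) ∷ R)) (clear-column a a≢0 b c D) ⟩
               det (suc n) ((a ∷ b) ∷ addRows ts (a ∷ b) (zipWith _∷_ (zeros n) D))         ≡⟨ det-addRows n (a ∷ b) ts (zipWith _∷_ (zeros n) D) ⟩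
               det (suc n) ((a ∷ b) ∷ zipWith _∷_ (zeros n) D)                              ≡⟨ det-block n a b D ⟩
               a * det n D                                                                  ∎))
               (𝟙-divide a≢0 (det n D) d)) ⟩
        detCount n (d * (a ⁻¹))
          ≡⟨ uniform _ (*-nonzero d≢0 (⁻¹-nonzero a≢0)) ⟩
        P ∎

    -- For fixed `D`, the bijection b ↦ b + D_i realises the addition of row i to the first row,
    -- which turns the corner 0 into c_i. It supplies a pivot when the corner has none.
    columnCount-move : ∀ c i → columnCount n d (lookup c i ∷ c) ≡ columnCount n d (0# ∷ c)
    columnCount-move c i = begin
      columnCount n d (lookup c i ∷ c)
        ≡⟨ ∑-swap (V n) (allMats n) (λ b D → 𝟙 (det (suc n) ((lookup c i ∷ b) ∷ zipWith _∷_ c D) ≟F d)) ⟩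
      ∑ (allMats n) (λ D → ∑ (V n) (λ b → 𝟙 (det (suc n) ((lookup c i ∷ b) ∷ zipWith _∷_ c D) ≟F d)))
        ≡⟨ ∑-cong (allMats n) (λ D → ∑-addmul 1# (lookup D i) (λ b → 𝟙 (det (suc n) ((lookup c i ∷ b) ∷ zipWith _∷_ c D) ≟F d))) ⟨
      ∑ (allMats n) (λ D → ∑ (V n) (λ b → 𝟙 (det (suc n) ((lookup c i ∷ addmul b 1# (lookup D i)) ∷ zipWith _∷_ c D) ≟F d)))
        ≡⟨ ∑-cong (allMats n) (λ D → ∑-cong (V n) (λ b → cong (λ z → 𝟙 (z ≟F d)) (moved D b))) ⟩
      ∑ (allMats n) (λ D → ∑ (V n) (λ b → 𝟙 (det (suc n) ((0# ∷ b) ∷ zipWith _∷_ c D) ≟F d)))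
        ≡⟨ ∑-swap (V n) (allMats n) (λ b D → 𝟙 (det (suc n) ((0# ∷ b) ∷ zipWith _∷_ c D) ≟F d)) ⟨
      columnCount n d (0# ∷ c) ∎
      where
      moved : ∀ D b → det (suc n) ((lookup c i ∷ addmul b 1# (lookup D i)) ∷ zipWith _∷_ c D) ≡ det (suc n) ((0# ∷ b) ∷ zipWith _∷_ c D)
      moved D b = begin
        det (suc n) ((lookup c i ∷ addmul b 1# (lookup D i)) ∷ R)
          ≡⟨ cong (λ z → det (suc n) ((z ∷ addmul b 1# (lookup D i)) ∷ R)) (trans (+-identityˡ _) (*-identityˡ _)) ⟨
        det (suc n) (addmul (0# ∷ b) 1# (lookup c i ∷ lookup D i) ∷ R)
          ≡⟨ cong (λ v → det (suc n) (addmul (0# ∷ b) 1# v ∷ R)) (Vecₚ.lookup-zipWith _∷_ i c D) ⟨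
        det (suc n) (addmul (0# ∷ b) 1# (lookup R i) ∷ R)
          ≡⟨ det-shift n (0# ∷ b) 1# R i ⟩
        det (suc n) ((0# ∷ b) ∷ R) ∎
        where R = zipWith _∷_ c D

    columnCount-nonzero : ∀ v i → lookup v i ≢ 0# → columnCount n d v ≡ pos (q ^ n) ℤ.* P
    columnCount-nonzero (a ∷ c) zero    a≢0 = columnCount-pivot a c a≢0
    columnCount-nonzero (a ∷ c) (suc i) c≢0 with a ≟F 0#
    ... | no  a≢0  = columnCount-pivot a c a≢0
    ... | yes refl = trans (sym (columnCount-move c i)) (columnCount-pivot (lookup c i) c c≢0)

    columnCount-zero : columnCount n d (zeros (suc n)) ≡ pos 0
    columnCount-zero = trans (∑-cong (V n) (λ b → trans (∑-cong (allMats n) (λ D →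
      𝟙-no (det (suc n) ((0# ∷ b) ∷ zipWith _∷_ (zeros n) D) ≟F d)
        (λ e → d≢0 (trans (sym e) (trans (det-block n 0# b D) (zeroˡ _)))))) (∑-zero (allMats n)))) (∑-zero (V n))

    -- The q^(n+1) - 1 nonzero first columns occur equally often, q^n P times each, and the zero
    -- column never.
    detCount-rec : detCount (suc n) d ≡ (pos (q ^ suc n) ℤ.- pos 1) ℤ.* (pos (q ^ n) ℤ.* P)
    detCount-rec = trans (detCount-columns n d)
      (∑-constant-off-zero (suc n) (columnCount n d) (pos (q ^ n) ℤ.* P) columnCount-nonzero columnCount-zero)

  -- The product of q^j - 1 over 2 ≤ j ≤ m + 1, spelled as in `nβ` so that for m = n - 1 the two
  -- agree by computation.
  orderFactor : ℕ → ℕ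
  orderFactor m = List.foldr ℕ._*_ 1 (List.map (λ j → q ^ (2 ℕ.+ j) ℕ.∸ 1) (upTo m))

  orderFactor-suc : ∀ m → orderFactor (suc m) ≡ orderFactor m ℕ.* (q ^ (2 ℕ.+ m) ℕ.∸ 1)
  orderFactor-suc m = begin
    product (List.map f (upTo (suc m)))        ≡⟨ cong (product ∘ List.map f) (Listₚ.upTo-∷ʳ m) ⟨
    product (List.map f (upTo m ++ m ∷ []))    ≡⟨ cong product (Listₚ.map-++ f (upTo m) (m ∷ [])) ⟩
    product (List.map f (upTo m) ++ f m ∷ [])  ≡⟨ product-++ (List.map f (upTo m)) (f m ∷ []) ⟩
    orderFactor m ℕ.* (f m ℕ.* 1)              ≡⟨ cong (orderFactor m ℕ.*_) (ℕₚ.*-identityʳ (f m)) ⟩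
    orderFactor m ℕ.* f m                      ∎
    where
    f : ℕ → ℕ
    f j = q ^ (2 ℕ.+ j) ℕ.∸ 1

  q>0 : 0 < q
  q>0 = subst (0 <_) (sym q≡2^r) (ℕₚ.m^n>0 2 r)

  q^>0 : ∀ n → 0 < q ^ n
  q^>0 n = ℕₚ.m^n>0 q {{ℕ.>-nonZero q>0}} n

  pos-∸1 : ∀ {m} → 0 < m → pos m ℤ.- pos 1 ≡ pos (m ℕ.∸ 1)
  pos-∸1 {suc m} _ = refl

  detCount-formula : ∀ n d → d ≢ 0# → detCount (suc n) d ≡ pos (q ^ (suc n C 2)) ℤ.* pos (orderFactor n)
  detCount-formula zero d d≢0 = begin
    detCount 1 d                                             ≡⟨ ∑-blocks 0 (λ M → 𝟙 (det 1 M ≟F d)) ⟩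
    ∑ (V 1) (λ x → 𝟙 (det 1 (x ∷ []) ≟F d)) ℤ.+ pos 0 ℤ.+ pos 0
                                                             ≡⟨ trans (ℤₚ.+-identityʳ _) (ℤₚ.+-identityʳ _) ⟩
    ∑ (V 1) (λ x → 𝟙 (det 1 (x ∷ []) ≟F d))                  ≡⟨ ∑-allVecs elements 0 _ ⟩
    ∑ elements (λ a → 𝟙 (det 1 ((a ∷ []) ∷ []) ≟F d) ℤ.+ pos 0)
      ≡⟨ ∑-cong elements (λ a → trans (ℤₚ.+-identityʳ _) (trans (cong (λ z → 𝟙 (z ≟F d)) (trans (det-block 0 a [] []) (*-identityʳ a))) (sym (ℤₚ.*-identityʳ _)))) ⟩
    ∑ elements (λ a → 𝟙 (a ≟F d) ℤ.* pos 1)                  ≡⟨ ∑-Fin-pick d (λ _ → pos 1) ⟩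
    pos 1                                                    ∎
  detCount-formula (suc n) d d≢0 = begin
    detCount (suc (suc n)) d
      ≡⟨ detCount-rec (suc n) (Q′ ℤ.* pos (orderFactor n)) (detCount-formula n) d d≢0 ⟩
    (pos (q ^ suc (suc n)) ℤ.- pos 1) ℤ.* (Q ℤ.* (Q′ ℤ.* pos (orderFactor n)))
      ≡⟨ cong (ℤ._* (Q ℤ.* (Q′ ℤ.* pos (orderFactor n)))) (pos-∸1 (q^>0 (suc (suc n)))) ⟩
    pos m ℤ.* (Q ℤ.* (Q′ ℤ.* pos (orderFactor n)))
      ≡⟨ comm (pos m) Q Q′ (pos (orderFactor n)) ⟩
    (Q ℤ.* Q′) ℤ.* (pos (orderFactor n) ℤ.* pos m)
      ≡⟨ cong₂ ℤ._*_ (trans (pos-^-+ q (suc n) (suc n C 2)) (cong (λ e → pos (q ^ e)) (sym ([2+n]C2 n))))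
           (trans (sym (ℤₚ.pos-* (orderFactor n) m)) (cong pos (sym (orderFactor-suc n)))) ⟩
    pos (q ^ (suc (suc n) C 2)) ℤ.* pos (orderFactor (suc n)) ∎
    where
    Q = pos (q ^ suc n)
    Q′ = pos (q ^ (suc n C 2))
    m = q ^ suc (suc n) ℕ.∸ 1
    comm : ∀ a b c d → a ℤ.* (b ℤ.* (c ℤ.* d)) ≡ (b ℤ.* c) ℤ.* (d ℤ.* a)
    comm = ℤSolver.solve-∀

  -- Scaling and Frobenius invariance of Kloosterman sums

  ∑-nonzero-permute : ∀ (π π⁻¹ : Elt → Elt) → (∀ x → π (π⁻¹ x) ≡ x) → (∀ x → π⁻¹ (π x) ≡ x) → π 0# ≡ 0# →
                      (f : Elt → ℤ) → ∑ nonzero (f ∘ π) ≡ ∑ nonzero f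
  ∑-nonzero-permute π π⁻¹ i j π0 f = begin
    ∑ nonzero (f ∘ π)                  ≡⟨ ∑-nonzero-minus (f ∘ π) ⟩
    ∑ elements (f ∘ π) ℤ.- f (π 0#)    ≡⟨ cong₂ (λ x y → x ℤ.- f y) (∑-Fin-permute π π⁻¹ i j f) π0 ⟩
    ∑ elements f ℤ.- f 0#              ≡⟨ ∑-nonzero-minus f ⟨
    ∑ nonzero f                        ∎

  ∑-nonzero-scale : ∀ {u} → u ≢ 0# → (f : Elt → ℤ) → ∑ nonzero (λ x → f (u * x)) ≡ ∑ nonzero f
  ∑-nonzero-scale {u} u≢0 = ∑-nonzero-permute (u *_) ((u ⁻¹) *_)
    (λ x → *-cancel-inverseʳ u x u≢0) (λ x → *-cancel-inverseˡ u x u≢0) (zeroʳ u)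

  -- K_m at `x` is a sum over m + 1 terms with product `x`; multiplying each of them by `u`
  -- multiplies the product by u^(m+1).
  Kl-scale : ∀ {u} → u ≢ 0# → ∀ φ m s x → Kl (λ z → φ (u * z)) m s x ≡ Kl φ m (u * s) (pow u (suc m) * x)
  Kl-scale {u} u≢0 φ zero    s x = cong φ (trans (distribˡ u s x) (cong (λ z → u * s + z * x) (sym (*-identityʳ u))))
  Kl-scale {u} u≢0 φ (suc m) s x = begin
    ∑ nonzero (λ α → Kl (λ z → φ (u * z)) m (s + α) (x * (α ⁻¹)))
      ≡⟨ ∑-nonzero-cong (λ α α≢0 → trans (Kl-scale u≢0 φ m (s + α) (x * (α ⁻¹)))
           (cong₂ (Kl φ m) (distribˡ u s α) (argument α α≢0))) ⟩
    ∑ nonzero (λ α → Kl φ m (u * s + u * α) (pow u (suc (suc m)) * x * ((u * α) ⁻¹)))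
      ≡⟨ ∑-nonzero-scale u≢0 (λ α → Kl φ m (u * s + α) (pow u (suc (suc m)) * x * (α ⁻¹))) ⟩
    ∑ nonzero (λ α → Kl φ m (u * s + α) (pow u (suc (suc m)) * x * (α ⁻¹))) ∎
    where
    argument : ∀ α → α ≢ 0# → pow u (suc m) * (x * (α ⁻¹)) ≡ pow u (suc (suc m)) * x * ((u * α) ⁻¹)
    argument α α≢0 = sym (begin
      u * pow u (suc m) * x * ((u * α) ⁻¹)             ≡⟨ cong (u * pow u (suc m) * x *_) (⁻¹-* u≢0 α≢0) ⟩
      u * pow u (suc m) * x * ((u ⁻¹) * (α ⁻¹))        ≡⟨ solve 5 (λ u p x v w → u :* p :* x :* (v :* w) := u :* (v :* (p :* (x :* w)))) refl u (pow u (suc m)) x (u ⁻¹) (α ⁻¹) ⟩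
      u * ((u ⁻¹) * (pow u (suc m) * (x * (α ⁻¹))))    ≡⟨ *-cancel-inverseʳ u _ u≢0 ⟩
      pow u (suc m) * (x * (α ⁻¹))                     ∎)

  -- Turns the accumulated product into an accumulated quotient. The inverse is unspecified at 0, so
  -- it splits over `p * α` only while `p` stays nonzero.
  klAux-Kl : ∀ a m s p → p ≢ 0# → klAux r a m s p ≡ Kl lam m s (a * (p ⁻¹))
  klAux-Kl a zero    s p p≢0 = refl
  klAux-Kl a (suc m) s p p≢0 = ∑-nonzero-cong (λ α α≢0 → trans (klAux-Kl a m (s + α) (p * α) (*-nonzero p≢0 α≢0))
    (cong (Kl lam m (s + α)) (trans (cong (a *_) (⁻¹-* p≢0 α≢0)) (sym (*-assoc a (p ⁻¹) (α ⁻¹))))))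

  module _ (0<r : 0 < r) where

    sqrt : Elt → Elt
    sqrt = frob (r ℕ.∸ 1)

    sq-sqrt : ∀ x → sq (sqrt x) ≡ x
    sq-sqrt x = trans (cong (λ m → frob m x) (ℕₚ.m+[n∸m]≡n 0<r)) (frob-order x)

    ∑-nonzero-sq : ∀ (f : Elt → ℤ) → ∑ nonzero (f ∘ sq) ≡ ∑ nonzero f
    ∑-nonzero-sq = ∑-nonzero-permute sq sqrt sq-sqrt (λ x → trans (frob-sq (r ℕ.∸ 1) x) (sq-sqrt x)) (zeroˡ 0#)

    -- Squaring permutes the nonzero elements and leaves λ unchanged, so each variable α may be
    -- replaced by its square.
    Kl-sq : ∀ m s x → Kl lam m (sq s) (sq x) ≡ Kl lam m s x
    Kl-sq zero    s x = trans (cong lam (sym (sq-+ s x))) (lam-sq (s + x))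
    Kl-sq (suc m) s x = begin
      ∑ nonzero (λ α → Kl lam m (sq s + α) (sq x * (α ⁻¹)))
        ≡⟨ ∑-nonzero-sq (λ α → Kl lam m (sq s + α) (sq x * (α ⁻¹))) ⟨
      ∑ nonzero (λ α → Kl lam m (sq s + sq α) (sq x * (sq α ⁻¹)))
        ≡⟨ ∑-nonzero-cong (λ α α≢0 → trans
             (cong₂ (Kl lam m) (sym (sq-+ s α)) (trans (cong (sq x *_) (⁻¹-* α≢0 α≢0)) (sym (sq-* x (α ⁻¹)))))
             (Kl-sq m (s + α) (x * (α ⁻¹)))) ⟩
      ∑ nonzero (λ α → Kl lam m (s + α) (x * (α ⁻¹))) ∎

    Kl-frob : ∀ k m x → Kl lam m 0# (frob k x) ≡ Kl lam m 0# x
    Kl-frob zero    m x = refl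
    Kl-frob (suc k) m x = trans (cong (λ z → Kl lam m z (sq (frob k x))) (sym (zeroˡ 0#)))
      (trans (Kl-sq m 0# (frob k x)) (Kl-frob k m x))

    lam-twist : ∀ {u} → u ≢ 0# → Character (λ z → lam (u * z))
    lam-twist {u} u≢0 = record
      { φ-+ = λ x y → trans (cong lam (distribˡ u x y)) (lam-+ (u * x) (u * y))
      ; φ-0 = trans (cong lam (zeroʳ u)) lam-0
      ; τ   = (u ⁻¹) * proj₁ t
      ; φ-τ = trans (cong lam (*-cancel-inverseʳ u _ u≢0)) (proj₂ t)
      }
      where t = lam-nontrivial 0<r

    lam-character : Character lam
    lam-character = record { φ-+ = lam-+ ; φ-0 = lam-0 ; τ = proj₁ t ; φ-τ = proj₂ t }
      where t = lam-nontrivial 0<r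

    -- Orthogonality and the Fourier transform of Kloosterman sums

    orthogonality : ∀ x → ∑ elements (λ u → lam (u * x)) ≡ pos q ℤ.* 𝟙 (x ≟F 0#)
    orthogonality x with x ≟F 0#
    ... | yes refl = trans (∑-cong elements (λ u → trans (cong lam (zeroʳ u)) lam-0)) (∑-elements-const (pos 1))
    ... | no  x≢0  = trans (∑-cong elements (λ u → cong lam (*-comm u x))) (trans (∑-character (lam-twist x≢0)) (sym (ℤₚ.*-zeroʳ (pos q))))

    orthogonality-nonzero : ∀ x → ∑ nonzero (λ u → lam (u * x)) ≡ pos q ℤ.* 𝟙 (x ≟F 0#) ℤ.- pos 1
    orthogonality-nonzero x = trans (∑-nonzero-minus (λ u → lam (u * x)))
      (cong₂ ℤ._-_ (orthogonality x) (trans (cong lam (zeroˡ x)) lam-0))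

    -- B m s = (-1)^(m + 1) λ(s) is what the excluded value u = 0 contributes to
    -- the Fourier transform of u ↦ K_m(λ; u).
    ε : ℕ → ℤ
    ε zero    = pos 1
    ε (suc m) = ℤ.- ε m

    B : ℕ → Elt → ℤ
    B m s = ℤ.- (ε m ℤ.* lam s)

    ∑-B : ∀ m s → ∑ nonzero (λ α → B m (s + α)) ≡ B (suc m) s
    ∑-B m s = begin
      ∑ nonzero (λ α → B m (s + α))                          ≡⟨ ∑-cong nonzero (λ α → trans (cong (λ z → ℤ.- (ε m ℤ.* z)) (lam-+ s α)) (lem₁ (ε m) (lam s) (lam α))) ⟩
      ∑ nonzero (λ α → (ℤ.- (ε m ℤ.* lam s)) ℤ.* lam α)      ≡⟨ ∑-*ˡ (ℤ.- (ε m ℤ.* lam s)) nonzero lam ⟩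
      (ℤ.- (ε m ℤ.* lam s)) ℤ.* ∑ nonzero lam                ≡⟨ ℤ*-congˡ (ℤ.- (ε m ℤ.* lam s)) (∑-nonzero-character lam-character) ⟩
      (ℤ.- (ε m ℤ.* lam s)) ℤ.* -[1+ 0 ]                     ≡⟨ lem₂ (ε m) (lam s) ⟩
      B (suc m) s                                            ∎
      where
      lem₁ : ∀ a b c → ℤ.- (a ℤ.* (b ℤ.* c)) ≡ (ℤ.- (a ℤ.* b)) ℤ.* c
      lem₁ = ℤSolver.solve-∀
      lem₂ : ∀ a b → (ℤ.- (a ℤ.* b)) ℤ.* -[1+ 0 ] ≡ ℤ.- ((ℤ.- a) ℤ.* b)
      lem₂ = ℤSolver.solve-∀

    -- The case of interest is s = 0, y = 1. General values serve the induction, in which splitting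
    -- off a variable α turns `s` into s + α and `y` into y/α.
    KlTransform : Elt → ℕ → Elt → Elt → ℤ
    KlTransform β m s y = ∑ nonzero (λ u → lam (u * β) ℤ.* Kl lam m s (u * y))

    KlTransform-suc : ∀ β m s y → KlTransform β (suc m) s y ≡ ∑ nonzero (λ α → KlTransform β m (s + α) (y * (α ⁻¹)))
    KlTransform-suc β m s y = begin
      ∑ nonzero (λ u → lam (u * β) ℤ.* ∑ nonzero (λ α → Kl lam m (s + α) (u * y * (α ⁻¹))))
        ≡⟨ ∑-cong nonzero (λ u → ∑-*ˡ (lam (u * β)) nonzero (λ α → Kl lam m (s + α) (u * y * (α ⁻¹)))) ⟨
      ∑ nonzero (λ u → ∑ nonzero (λ α → lam (u * β) ℤ.* Kl lam m (s + α) (u * y * (α ⁻¹))))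
        ≡⟨ ∑-swap nonzero nonzero (λ u α → lam (u * β) ℤ.* Kl lam m (s + α) (u * y * (α ⁻¹))) ⟩
      ∑ nonzero (λ α → ∑ nonzero (λ u → lam (u * β) ℤ.* Kl lam m (s + α) (u * y * (α ⁻¹))))
        ≡⟨ ∑-cong nonzero (λ α → ∑-cong nonzero (λ u → cong (λ z → lam (u * β) ℤ.* Kl lam m (s + α) z) (*-assoc u y (α ⁻¹)))) ⟩
      ∑ nonzero (λ α → KlTransform β m (s + α) (y * (α ⁻¹))) ∎

    KlTransform-base : ∀ β s y → KlTransform β 0 s y ≡ pos q ℤ.* (𝟙 ((β + y) ≟F 0#) ℤ.* lam s) ℤ.+ B 0 s
    KlTransform-base β s y = begin
      ∑ nonzero (λ u → lam (u * β) ℤ.* lam (s + u * y))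
        ≡⟨ ∑-cong nonzero (λ u → trans (ℤ*-congˡ (lam (u * β)) (lam-+ s (u * y)))
             (trans (ℤ*-leftComm (lam (u * β)) (lam s) (lam (u * y)))
               (ℤ*-congˡ (lam s) (sym (trans (cong lam (distribˡ u β y)) (lam-+ (u * β) (u * y))))))) ⟩
      ∑ nonzero (λ u → lam s ℤ.* lam (u * (β + y)))
        ≡⟨ ∑-*ˡ (lam s) nonzero (λ u → lam (u * (β + y))) ⟩
      lam s ℤ.* ∑ nonzero (λ u → lam (u * (β + y)))
        ≡⟨ ℤ*-congˡ (lam s) (orthogonality-nonzero (β + y)) ⟩
      lam s ℤ.* (pos q ℤ.* 𝟙 ((β + y) ≟F 0#) ℤ.- pos 1)
        ≡⟨ lem₂ (lam s) (pos q) (𝟙 ((β + y) ≟F 0#)) ⟩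
      pos q ℤ.* (𝟙 ((β + y) ≟F 0#) ℤ.* lam s) ℤ.+ B 0 s ∎
      where
      lem₂ : ∀ l q i → l ℤ.* (q ℤ.* i ℤ.- pos 1) ≡ q ℤ.* (i ℤ.* l) ℤ.+ ℤ.- (pos 1 ℤ.* l)
      lem₂ = ℤSolver.solve-∀

    -- Orthogonality would require `y` divided by all variables to be 0, which is impossible; only
    -- the correction for the excluded u = 0 is left.
    KlTransform-zero : ∀ m s y → y ≢ 0# → KlTransform 0# m s y ≡ B m s
    KlTransform-zero zero s y y≢0 = begin
      KlTransform 0# 0 s y                                ≡⟨ KlTransform-base 0# s y ⟩
      pos q ℤ.* (𝟙 ((0# + y) ≟F 0#) ℤ.* lam s) ℤ.+ B 0 s  ≡⟨ cong (λ z → pos q ℤ.* (z ℤ.* lam s) ℤ.+ B 0 s)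
                                                                    (𝟙-no ((0# + y) ≟F 0#) (y≢0 ∘ trans (sym (+-identityˡ y)))) ⟩
      pos q ℤ.* pos 0 ℤ.+ B 0 s                                ≡⟨ cong (ℤ._+ B 0 s) (ℤₚ.*-zeroʳ (pos q)) ⟩
      pos 0 ℤ.+ B 0 s                                          ≡⟨ ℤₚ.+-identityˡ _ ⟩
      B 0 s                                                    ∎
    KlTransform-zero (suc m) s y y≢0 = trans (KlTransform-suc 0# m s y)
      (trans (∑-nonzero-cong (λ α α≢0 → KlTransform-zero m (s + α) (y * (α ⁻¹)) (*-nonzero y≢0 (⁻¹-nonzero α≢0)))) (∑-B m s))

    -- Orthogonality forces `y` divided by all m + 1 variables to equal β. This determines the last
    -- variable, and its value is exactly the closing term of K_m at y/β; hence the index drops by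
    -- one.
    KlTransform-nonzero : ∀ β → β ≢ 0# → ∀ m s y → y ≢ 0# → KlTransform β (suc m) s y ≡ pos q ℤ.* Kl lam m s (y * (β ⁻¹)) ℤ.+ B (suc m) s
    KlTransform-nonzero β β≢0 zero s y y≢0 = begin
      KlTransform β 1 s y
        ≡⟨ KlTransform-suc β 0 s y ⟩
      ∑ nonzero (λ α → KlTransform β 0 (s + α) (y * (α ⁻¹)))
        ≡⟨ ∑-nonzero-cong (λ α α≢0 → trans (KlTransform-base β (s + α) (y * (α ⁻¹)))
             (cong (λ z → pos q ℤ.* (z ℤ.* lam (s + α)) ℤ.+ B 0 (s + α)) (indicator α α≢0))) ⟩
      ∑ nonzero (λ α → pos q ℤ.* (𝟙 (α ≟F z) ℤ.* lam (s + α)) ℤ.+ B 0 (s + α))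
        ≡⟨ ∑-+ nonzero (λ α → pos q ℤ.* (𝟙 (α ≟F z) ℤ.* lam (s + α))) (λ α → B 0 (s + α)) ⟩
      ∑ nonzero (λ α → pos q ℤ.* (𝟙 (α ≟F z) ℤ.* lam (s + α))) ℤ.+ ∑ nonzero (λ α → B 0 (s + α))
        ≡⟨ cong₂ ℤ._+_ (∑-*ˡ (pos q) nonzero (λ α → 𝟙 (α ≟F z) ℤ.* lam (s + α))) (∑-B 0 s) ⟩
      pos q ℤ.* ∑ nonzero (λ α → 𝟙 (α ≟F z) ℤ.* lam (s + α)) ℤ.+ B 1 s
        ≡⟨ cong (λ w → pos q ℤ.* w ℤ.+ B 1 s) (∑-nonzero-vanishing (λ α → 𝟙 (α ≟F z) ℤ.* lam (s + α))
             (cong (ℤ._* lam (s + 0#)) (𝟙-no (0# ≟F z) (z≢0 ∘ sym)))) ⟨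
      pos q ℤ.* ∑ elements (λ α → 𝟙 (α ≟F z) ℤ.* lam (s + α)) ℤ.+ B 1 s
        ≡⟨ cong (λ w → pos q ℤ.* w ℤ.+ B 1 s) (∑-Fin-pick z (λ α → lam (s + α))) ⟩
      pos q ℤ.* lam (s + z) ℤ.+ B 1 s ∎
      where
      z = y * (β ⁻¹)
      z≢0 : z ≢ 0#
      z≢0 = *-nonzero y≢0 (⁻¹-nonzero β≢0)
      indicator : ∀ α → α ≢ 0# → 𝟙 ((β + y * (α ⁻¹)) ≟F 0#) ≡ 𝟙 (α ≟F z)
      indicator α α≢0 = begin
        𝟙 ((β + y * (α ⁻¹)) ≟F 0#)   ≡⟨ 𝟙-⇔ ((β + y * (α ⁻¹)) ≟F 0#) (β ≟F (y * (α ⁻¹))) x+y≡0⇒x≡y (λ e → trans (cong (_+ y * (α ⁻¹)) e) (x+x≡0 _)) ⟩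
        𝟙 (β ≟F (y * (α ⁻¹)))        ≡⟨ 𝟙-divide α≢0 β y ⟨
        𝟙 ((α * β) ≟F y)             ≡⟨ cong (λ w → 𝟙 (w ≟F y)) (*-comm α β) ⟩
        𝟙 ((β * α) ≟F y)             ≡⟨ 𝟙-divide β≢0 α y ⟩
        𝟙 (α ≟F z)                   ∎
    KlTransform-nonzero β β≢0 (suc m) s y y≢0 = begin
      KlTransform β (suc (suc m)) s y
        ≡⟨ KlTransform-suc β (suc m) s y ⟩
      ∑ nonzero (λ α → KlTransform β (suc m) (s + α) (y * (α ⁻¹)))
        ≡⟨ ∑-nonzero-cong (λ α α≢0 → trans (KlTransform-nonzero β β≢0 m (s + α) (y * (α ⁻¹)) (*-nonzero y≢0 (⁻¹-nonzero α≢0)))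
             (cong (λ w → pos q ℤ.* Kl lam m (s + α) w ℤ.+ B (suc m) (s + α))
               (solve 3 (λ a b c → a :* b :* c := a :* c :* b) refl y (α ⁻¹) (β ⁻¹)))) ⟩
      ∑ nonzero (λ α → pos q ℤ.* Kl lam m (s + α) (y * (β ⁻¹) * (α ⁻¹)) ℤ.+ B (suc m) (s + α))
        ≡⟨ ∑-+ nonzero (λ α → pos q ℤ.* Kl lam m (s + α) (y * (β ⁻¹) * (α ⁻¹))) (λ α → B (suc m) (s + α)) ⟩
      ∑ nonzero (λ α → pos q ℤ.* Kl lam m (s + α) (y * (β ⁻¹) * (α ⁻¹))) ℤ.+ ∑ nonzero (λ α → B (suc m) (s + α))
        ≡⟨ cong₂ ℤ._+_ (∑-*ˡ (pos q) nonzero (λ α → Kl lam m (s + α) (y * (β ⁻¹) * (α ⁻¹)))) (∑-B (suc m) s) ⟩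
      pos q ℤ.* Kl lam (suc m) s (y * (β ⁻¹)) ℤ.+ B (suc (suc m)) s ∎

    ε-+ : ∀ m → ε (m ℕ.+ m) ≡ pos 1
    ε-+ zero    = refl
    ε-+ (suc m) = trans (cong (ℤ.-_ ∘ ε) (ℕₚ.+-suc m m)) (trans (ℤₚ.neg-involutive (ε (m ℕ.+ m))) (ε-+ m))

    -- Matrices of determinant 1 with a given trace

    traceCount : ∀ n → Elt → ℤ
    traceCount n β = ∑ (allMats n) (λ M → 𝟙 (det n M ≟F 1#) ℤ.* 𝟙 (matTrace n M ≟F β))

    traceCount-length : ∀ n β → pos (length (filter (_≟F β) (traceVec n))) ≡ traceCount n β
    traceCount-length n β = begin
      pos (length (filter (_≟F β) (traceVec n)))     ≡⟨ length-filter-∑ (_≟F β) (traceVec n) ⟩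
      ∑ (traceVec n) (λ t → 𝟙 (t ≟F β))              ≡⟨ ∑-map (matTrace n) (SL n) (λ t → 𝟙 (t ≟F β)) ⟩
      ∑ (SL n) (λ M → 𝟙 (matTrace n M ≟F β))         ≡⟨ ∑-filter (λ M → det n M ≟F 1#) (allMats n) (λ M → 𝟙 (matTrace n M ≟F β)) ⟩
      traceCount n β                                 ∎

    twistedSum : ∀ n → Elt → ℤ
    twistedSum n u = ∑ (allMats n) (λ M → 𝟙 (det n M ≟F 1#) ℤ.* lam (u * matTrace n M))

    traceCount-fourier : ∀ n β → pos q ℤ.* traceCount n β ≡ ∑ elements (λ u → lam (u * β) ℤ.* twistedSum n u)
    traceCount-fourier n β = begin
      pos q ℤ.* traceCount n β
        ≡⟨ ∑-*ˡ (pos q) (allMats n) (λ M → 𝟙 (det n M ≟F 1#) ℤ.* 𝟙 (matTrace n M ≟F β)) ⟨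
      ∑ (allMats n) (λ M → pos q ℤ.* (𝟙 (det n M ≟F 1#) ℤ.* 𝟙 (matTrace n M ≟F β)))
        ≡⟨ ∑-cong (allMats n) (λ M → expand M) ⟩
      ∑ (allMats n) (λ M → ∑ elements (λ u → lam (u * β) ℤ.* (𝟙 (det n M ≟F 1#) ℤ.* lam (u * matTrace n M))))
        ≡⟨ ∑-swap (allMats n) elements _ ⟩
      ∑ elements (λ u → ∑ (allMats n) (λ M → lam (u * β) ℤ.* (𝟙 (det n M ≟F 1#) ℤ.* lam (u * matTrace n M))))
        ≡⟨ ∑-cong elements (λ u → ∑-*ˡ (lam (u * β)) (allMats n) (λ M → 𝟙 (det n M ≟F 1#) ℤ.* lam (u * matTrace n M))) ⟩
      ∑ elements (λ u → lam (u * β) ℤ.* twistedSum n u) ∎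
      where
      lem₂ : ∀ a b c → a ℤ.* (b ℤ.* c) ≡ c ℤ.* (a ℤ.* b)
      lem₂ = ℤSolver.solve-∀
      expand : ∀ M → pos q ℤ.* (𝟙 (det n M ≟F 1#) ℤ.* 𝟙 (matTrace n M ≟F β)) ≡
                     ∑ elements (λ u → lam (u * β) ℤ.* (𝟙 (det n M ≟F 1#) ℤ.* lam (u * matTrace n M)))
      expand M = begin
        pos q ℤ.* (D ℤ.* 𝟙 (t ≟F β))                          ≡⟨ ℤ*-leftComm (pos q) D (𝟙 (t ≟F β)) ⟩
        D ℤ.* (pos q ℤ.* 𝟙 (t ≟F β))                          ≡⟨ cong (λ z → D ℤ.* (pos q ℤ.* z)) (𝟙-⇔ (t ≟F β) ((t + β) ≟F 0#)
                                                                   (λ e → trans (cong (_+ β) e) (x+x≡0 β)) x+y≡0⇒x≡y) ⟩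
        D ℤ.* (pos q ℤ.* 𝟙 ((t + β) ≟F 0#))                   ≡⟨ ℤ*-congˡ D (orthogonality (t + β)) ⟨
        D ℤ.* ∑ elements (λ u → lam (u * (t + β)))            ≡⟨ ∑-*ˡ D elements (λ u → lam (u * (t + β))) ⟨
        ∑ elements (λ u → D ℤ.* lam (u * (t + β)))            ≡⟨ ∑-cong elements (λ u → trans
                                                                   (ℤ*-congˡ D (trans (cong lam (distribˡ u t β)) (lam-+ (u * t) (u * β))))
                                                                   (lem₂ D (lam (u * t)) (lam (u * β)))) ⟩
        ∑ elements (λ u → lam (u * β) ℤ.* (D ℤ.* lam (u * t))) ∎
        where
        D = 𝟙 (det n M ≟F 1#)
        t = matTrace n M

    twistedSum-zero : ∀ n → twistedSum n 0# ≡ detCount n 1#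
    twistedSum-zero n = ∑-cong (allMats n) (λ M →
      trans (ℤ*-congˡ (𝟙 (det n M ≟F 1#)) (trans (cong lam (zeroˡ _)) lam-0)) (ℤₚ.*-identityʳ _))

    -- The argument is left as `u * 1#`, the form in which it enters `KlTransform` at y = 1.
    twistedSum-nonzero : ∀ s n → 2 ^ s ≡ suc n → ∀ u → u ≢ 0# →
                         twistedSum (suc n) u ≡ pos (q ^ (suc n C 2)) ℤ.* Kl lam n 0# (u * 1#)
    twistedSum-nonzero s n 2^s≡1+n u u≢0 = trans (gaussSum-Kl (lam-twist u≢0) n 1# (0≢1 ∘ sym)) (ℤ*-congˡ (pos (q ^ (suc n C 2))) (begin
      Kl (λ z → lam (u * z)) n 0# 1#           ≡⟨ Kl-scale u≢0 lam n 0# 1# ⟩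
      Kl lam n (u * 0#) (pow u (suc n) * 1#)   ≡⟨ cong₂ (Kl lam n) (zeroʳ u) (*-identityʳ _) ⟩
      Kl lam n 0# (pow u (suc n))              ≡⟨ cong (λ m → Kl lam n 0# (pow u m)) 2^s≡1+n ⟨
      Kl lam n 0# (pow u (2 ^ s))              ≡⟨ cong (Kl lam n 0#) (pow-2^ s u) ⟩
      Kl lam n 0# (frob s u)                   ≡⟨ Kl-frob s n u ⟩
      Kl lam n 0# u                            ≡⟨ cong (Kl lam n 0#) (*-identityʳ u) ⟨
      Kl lam n 0# (u * 1#)                     ∎))

    KlTransform-θ : ∀ n β → B (suc n) 0# ≡ pos 1 → KlTransform β (suc n) 0# 1# ≡ pos q ℤ.* θ r (suc (suc n)) β ℤ.+ pos 1
    KlTransform-θ n β B≡1 with β ≟F 0#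
    ... | yes refl = begin
      KlTransform 0# (suc n) 0# 1#  ≡⟨ KlTransform-zero (suc n) 0# 1# (0≢1 ∘ sym) ⟩
      B (suc n) 0#                  ≡⟨ B≡1 ⟩
      pos 1                         ≡⟨ cong (ℤ._+ pos 1) (ℤₚ.*-zeroʳ (pos q)) ⟨
      pos q ℤ.* pos 0 ℤ.+ pos 1     ∎
    ... | no β≢0 = begin
      KlTransform β (suc n) 0# 1#                           ≡⟨ KlTransform-nonzero β β≢0 n 0# 1# (0≢1 ∘ sym) ⟩
      pos q ℤ.* Kl lam n 0# (1# * (β ⁻¹)) ℤ.+ B (suc n) 0#  ≡⟨ cong₂ (λ x y → pos q ℤ.* Kl lam n 0# x ℤ.+ y)
                                                                      (trans (*-comm 1# (β ⁻¹)) (cong ((β ⁻¹) *_) (sym 1⁻¹≡1))) B≡1 ⟩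
      pos q ℤ.* Kl lam n 0# ((β ⁻¹) * (1# ⁻¹)) ℤ.+ pos 1         ≡⟨ cong (λ z → pos q ℤ.* z ℤ.+ pos 1) (klAux-Kl (β ⁻¹) n 0# 1# (0≢1 ∘ sym)) ⟨
      pos q ℤ.* K r n (β ⁻¹) ℤ.+ pos 1                           ∎

    -- The correction is -1 to the power of the matrix size 2^s, which is even because s > 0.
    B-even : ∀ s n → 0 < s → 2 ^ s ≡ suc (suc n) → B (suc n) 0# ≡ pos 1
    B-even (suc s) n _ 2^s≡2+n = begin
      ℤ.- (ε (suc n) ℤ.* lam 0#)     ≡⟨ cong (λ z → ℤ.- (ε (suc n) ℤ.* z)) lam-0 ⟩
      ℤ.- (ε (suc n) ℤ.* pos 1)      ≡⟨ cong ℤ.-_ (ℤₚ.*-identityʳ (ε (suc n))) ⟩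
      ε (suc (suc n))                ≡⟨ cong ε 2^s≡2+n ⟨
      ε (2 ^ s ℕ.+ (2 ^ s ℕ.+ 0))    ≡⟨ cong (λ m → ε (2 ^ s ℕ.+ m)) (ℕₚ.+-identityʳ (2 ^ s)) ⟩
      ε (2 ^ s ℕ.+ 2 ^ s)            ≡⟨ ε-+ (2 ^ s) ⟩
      pos 1                          ∎

    traceCount-formula : ∀ s n → 0 < s → 2 ^ s ≡ suc (suc n) → ∀ β → traceCount (suc (suc n)) β ≡ nβ r (suc (suc n)) β
    -- Fourier inversion yields `q` times the count. The `q` to be cancelled is taken out of q^(N
    -- choose 2), which is possible since N ≥ 2 makes that exponent positive.
    traceCount-formula s n 0<s 2^s≡2+n β = ℤₚ.*-cancelˡ-≡ (pos q) _ _ {{ℕ.>-nonZero q>0}} (begin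
      pos q ℤ.* traceCount N β
        ≡⟨ traceCount-fourier N β ⟩
      ∑ elements (λ u → lam (u * β) ℤ.* twistedSum N u)
        ≡⟨ ∑-nonzero (λ u → lam (u * β) ℤ.* twistedSum N u) ⟩
      lam (0# * β) ℤ.* twistedSum N 0# ℤ.+ ∑ nonzero (λ u → lam (u * β) ℤ.* twistedSum N u)
        ≡⟨ cong₂ ℤ._+_
             (trans (cong₂ ℤ._*_ (trans (cong lam (zeroˡ β)) lam-0) (trans (twistedSum-zero N) (detCount-formula (suc n) 1# (0≢1 ∘ sym))))
                    (ℤₚ.*-identityˡ (Q ℤ.* P)))
             (begin
               ∑ nonzero (λ u → lam (u * β) ℤ.* twistedSum N u)
                 ≡⟨ ∑-nonzero-cong (λ u u≢0 → trans (ℤ*-congˡ (lam (u * β)) (twistedSum-nonzero s (suc n) 2^s≡2+n u u≢0))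
                      (ℤ*-leftComm (lam (u * β)) Q (Kl lam (suc n) 0# (u * 1#)))) ⟩
               ∑ nonzero (λ u → Q ℤ.* (lam (u * β) ℤ.* Kl lam (suc n) 0# (u * 1#)))
                 ≡⟨ ∑-*ˡ Q nonzero (λ u → lam (u * β) ℤ.* Kl lam (suc n) 0# (u * 1#)) ⟩
               Q ℤ.* KlTransform β (suc n) 0# 1#
                 ≡⟨ ℤ*-congˡ Q (KlTransform-θ n β (B-even s n 0<s 2^s≡2+n)) ⟩
               Q ℤ.* (pos q ℤ.* Θ ℤ.+ pos 1) ∎) ⟩
      Q ℤ.* P ℤ.+ Q ℤ.* (pos q ℤ.* Θ ℤ.+ pos 1)
        ≡⟨ lem₂ Q P (pos q ℤ.* Θ) ⟩
      Q ℤ.* (P ℤ.+ pos 1 ℤ.+ pos q ℤ.* Θ)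
        ≡⟨ cong (ℤ._* (P ℤ.+ pos 1 ℤ.+ pos q ℤ.* Θ)) Q≡q*Q′ ⟩
      pos q ℤ.* Q′ ℤ.* (P ℤ.+ pos 1 ℤ.+ pos q ℤ.* Θ)
        ≡⟨ ℤₚ.*-assoc (pos q) Q′ (P ℤ.+ pos 1 ℤ.+ pos q ℤ.* Θ) ⟩
      pos q ℤ.* nβ r N β ∎)
      where
      N = suc (suc n)
      Q = pos (q ^ (N C 2))
      Q′ = pos (q ^ ((N C 2) ℕ.∸ 1))
      P = pos (orderFactor (suc n))
      Θ = θ r N β
      1≤C : 1 ≤ N C 2
      1≤C = subst (1 ≤_) (sym ([2+n]C2 n)) (s≤s z≤n)
      Q≡q*Q′ : Q ≡ pos q ℤ.* Q′
      Q≡q*Q′ = trans (cong (λ e → pos (q ^ e)) (sym (ℕₚ.m+[n∸m]≡n 1≤C))) (ℤₚ.pos-* q (q ^ ((N C 2) ℕ.∸ 1)))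
      lem₂ : ∀ a b c → a ℤ.* b ℤ.+ a ℤ.* (c ℤ.+ pos 1) ≡ a ℤ.* (b ℤ.+ pos 1 ℤ.+ c)
      lem₂ = ℤSolver.solve-∀

-- Pascal's rule for truncated sums

∑-upTo-suc : ∀ n f → ∑ (upTo (suc n)) f ≡ ∑ (upTo n) f ℤ.+ f n
∑-upTo-suc n f = begin
  ∑ (upTo (suc n)) f                ≡⟨ cong (λ l → ∑ l f) (Listₚ.upTo-∷ʳ n) ⟨
  ∑ (upTo n ++ n ∷ []) f            ≡⟨ ∑-++ (upTo n) (n ∷ []) f ⟩
  ∑ (upTo n) f ℤ.+ (f n ℤ.+ pos 0)  ≡⟨ ℤ+-congˡ (∑ (upTo n) f) (ℤₚ.+-identityʳ (f n)) ⟩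
  ∑ (upTo n) f ℤ.+ f n              ∎

pos-pascal : ∀ a k → pos (suc a C suc k) ≡ pos (a C k) ℤ.+ pos (a C suc k)
pos-pascal a k = trans (cong pos (sym (nCk+nC[k+1]≡[n+1]C[k+1] a k))) (ℤₚ.pos-+ (a C k) (a C suc k))

-- Pascal's rule under a sum cut off at `b`. The shifted sum on the right reaches h(b + 1), which
-- the left sum does not; the extra term on the left balances it and makes the identity hold for
-- every `h`.
pascal-sum : ∀ a (h : ℕ → ℤ) b →
             ∑ (upTo (suc b)) (λ k → pos (suc a C k) ℤ.* h k) ℤ.+ pos (a C b) ℤ.* h (suc b) ≡
             ∑ (upTo (suc b)) (λ k → pos (a C k) ℤ.* h k) ℤ.+ ∑ (upTo (suc b)) (λ k → pos (a C k) ℤ.* h (suc k))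
pascal-sum a h zero    = lem (h 0) (h 1)
  where
  lem : ∀ x y → pos 1 ℤ.* x ℤ.+ pos 0 ℤ.+ pos 1 ℤ.* y ≡ pos 1 ℤ.* x ℤ.+ pos 0 ℤ.+ (pos 1 ℤ.* y ℤ.+ pos 0)
  lem = ℤSolver.solve-∀
pascal-sum a h (suc b) = begin
  ∑ (upTo (suc (suc b))) f′ ℤ.+ y ℤ.* h₂                     ≡⟨ cong (ℤ._+ y ℤ.* h₂) (∑-upTo-suc (suc b) f′) ⟩
  X′ ℤ.+ pos (suc a C suc b) ℤ.* h₁ ℤ.+ y ℤ.* h₂             ≡⟨ cong (λ z → X′ ℤ.+ z ℤ.* h₁ ℤ.+ y ℤ.* h₂) (pos-pascal a b) ⟩
  X′ ℤ.+ (x ℤ.+ y) ℤ.* h₁ ℤ.+ y ℤ.* h₂                       ≡⟨ lem₁ X′ x y h₁ h₂ ⟩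
  X′ ℤ.+ x ℤ.* h₁ ℤ.+ (y ℤ.* h₁ ℤ.+ y ℤ.* h₂)                ≡⟨ cong (ℤ._+ (y ℤ.* h₁ ℤ.+ y ℤ.* h₂)) (pascal-sum a h b) ⟩
  X ℤ.+ Y ℤ.+ (y ℤ.* h₁ ℤ.+ y ℤ.* h₂)                        ≡⟨ lem₂ X Y (y ℤ.* h₁) (y ℤ.* h₂) ⟩
  X ℤ.+ y ℤ.* h₁ ℤ.+ (Y ℤ.+ y ℤ.* h₂)                        ≡⟨ cong₂ ℤ._+_ (∑-upTo-suc (suc b) f) (∑-upTo-suc (suc b) g) ⟨
  ∑ (upTo (suc (suc b))) f ℤ.+ ∑ (upTo (suc (suc b))) g      ∎
  where
  f f′ g : ℕ → ℤ
  f  k = pos (a C k) ℤ.* h k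
  f′ k = pos (suc a C k) ℤ.* h k
  g  k = pos (a C k) ℤ.* h (suc k)
  X = ∑ (upTo (suc b)) f
  X′ = ∑ (upTo (suc b)) f′
  Y = ∑ (upTo (suc b)) g
  x = pos (a C b)
  y = pos (a C suc b)
  h₁ = h (suc b)
  h₂ = h (suc (suc b))
  lem₁ : ∀ X x y u v → X ℤ.+ (x ℤ.+ y) ℤ.* u ℤ.+ y ℤ.* v ≡ X ℤ.+ x ℤ.* u ℤ.+ (y ℤ.* u ℤ.+ y ℤ.* v)
  lem₁ = ℤSolver.solve-∀
  lem₂ : ∀ X Y u v → X ℤ.+ Y ℤ.+ (u ℤ.+ v) ≡ X ℤ.+ u ℤ.+ (Y ℤ.+ v)
  lem₂ = ℤSolver.solve-∀

∑-0C : ∀ (h : ℕ → ℤ) b → ∑ (upTo (suc b)) (λ k → pos (0 C k) ℤ.* h k) ≡ h 0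
∑-0C h zero    = trans (ℤₚ.+-identityʳ _) (ℤₚ.*-identityˡ (h 0))
∑-0C h (suc b) = trans (∑-upTo-suc (suc b) (λ k → pos (0 C k) ℤ.* h k)) (trans (ℤₚ.+-identityʳ _) (∑-0C h b))

-- Words sorted by how many coordinates of each value they choose

module WeightEnumerator {q : ℕ} (F : FiniteField q) where
  open FiniteField F renaming (_+_ to infixl 6 _+_; _*_ to infixl 7 _*_)
  open FieldDefs F
  open FieldArithmetic F

  binomials : ∀ {n} → (Fin n → ℕ) → Vec ℕ n → ℤ
  binomials m ν = List.foldr ℤ._*_ (pos 1) (List.tabulate (λ β → pos (m β C lookup ν β)))

  module _ (b : ℕ) where

    -- The sum over families cut off at `b`, as in `families`, with the constraints replaced by a
    -- test function `g`. The number `n` of classes is free so that induction can remove one class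
    -- at a time.
    S : ∀ {n} → (Fin n → ℕ) → (Vec ℕ n → ℤ) → ℤ
    S {n} m g = ∑ (allVecs (upTo (suc b)) n) (λ ν → binomials m ν ℤ.* g ν)

    S-suc : ∀ {n} (m : Fin (suc n) → ℕ) g →
            S m g ≡ ∑ (upTo (suc b)) (λ k → pos (m zero C k) ℤ.* S (m ∘ suc) (λ ν → g (k ∷ ν)))
    S-suc {n} m g = trans (∑-allVecs (upTo (suc b)) n (λ ν → binomials m ν ℤ.* g ν))
      (∑-cong (upTo (suc b)) (λ k → trans
        (∑-cong (allVecs (upTo (suc b)) n) (λ ν → ℤₚ.*-assoc (pos (m zero C k)) (binomials (m ∘ suc) ν) (g (k ∷ ν))))
        (∑-*ˡ (pos (m zero C k)) (allVecs (upTo (suc b)) n) (λ ν → binomials (m ∘ suc) ν ℤ.* g (k ∷ ν)))))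

    S-cong : ∀ {n} {m m′ : Fin n → ℕ} {g g′} → (∀ β → m β ≡ m′ β) → (∀ ν → g ν ≡ g′ ν) → S m g ≡ S m′ g′
    S-cong {n} e e′ = ∑-cong (allVecs (upTo (suc b)) n) (λ ν → cong₂ ℤ._*_
      (cong (List.foldr ℤ._*_ (pos 1)) (Listₚ.tabulate-cong (λ β → cong (λ a → pos (a C lookup ν β)) (e β)))) (e′ ν))

    S-vanishing : ∀ {n} (m : Fin n → ℕ) g → (∀ ν → g ν ≡ pos 0) → S m g ≡ pos 0
    S-vanishing {n} m g e = trans
      (∑-cong (allVecs (upTo (suc b)) n) (λ ν → trans (ℤ*-congˡ (binomials m ν) (e ν)) (ℤₚ.*-zeroʳ (binomials m ν))))
      (∑-zero (allVecs (upTo (suc b)) n))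

    S-zero : ∀ {n} (g : Vec ℕ n → ℤ) → S (λ _ → 0) g ≡ g (replicate n 0)
    S-zero {zero}  g = trans (ℤₚ.+-identityʳ _) (ℤₚ.*-identityˡ _)
    S-zero {suc n} g = begin
      S (λ _ → 0) g                                                                 ≡⟨ S-suc (λ _ → 0) g ⟩
      ∑ (upTo (suc b)) (λ k → pos (0 C k) ℤ.* S (λ _ → 0) (λ ν → g (k ∷ ν)))        ≡⟨ ∑-0C (λ k → S (λ _ → 0) (λ ν → g (k ∷ ν))) b ⟩
      S (λ _ → 0) (λ ν → g (0 ∷ ν))                                                 ≡⟨ S-zero (λ ν → g (0 ∷ ν)) ⟩
      g (replicate (suc n) 0)                                                       ∎

    -- Enlarging class `x` by one coordinate is Pascal's rule at `x`: the new coordinate is either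
    -- left out or chosen. The cutoff loses the term with b + 1 choices from class `x`, so `g` has
    -- to vanish there.
    S-increment : ∀ {n} (x : Fin n) (m m′ : Fin n → ℕ) → m′ x ≡ suc (m x) → (∀ β → β ≢ x → m′ β ≡ m β) →
                  ∀ g → (∀ ν → b < lookup ν x → g ν ≡ pos 0) →
                  S m′ g ≡ S m g ℤ.+ S m (λ ν → g (Vec.updateAt ν x suc))
    S-increment zero m m′ e e′ g g0 = begin
      S m′ g
        ≡⟨ S-suc m′ g ⟩
      ∑ (upTo (suc b)) (λ k → pos (m′ zero C k) ℤ.* S (m′ ∘ suc) (λ ν → g (k ∷ ν)))
        ≡⟨ ∑-cong (upTo (suc b)) (λ k → cong₂ (λ a z → pos (a C k) ℤ.* z) e (S-cong (λ β → e′ (suc β) λ ()) (λ ν → refl))) ⟩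
      ∑ (upTo (suc b)) (λ k → pos (suc a C k) ℤ.* h k)
        ≡⟨ ℤₚ.+-identityʳ _ ⟨
      ∑ (upTo (suc b)) (λ k → pos (suc a C k) ℤ.* h k) ℤ.+ pos 0
        ≡⟨ ℤ+-congˡ (∑ (upTo (suc b)) (λ k → pos (suc a C k) ℤ.* h k))
             (trans (ℤ*-congˡ (pos (a C b)) (S-vanishing (m ∘ suc) (λ ν → g (suc b ∷ ν)) (λ ν → g0 (suc b ∷ ν) ℕₚ.≤-refl))) (ℤₚ.*-zeroʳ (pos (a C b)))) ⟨
      ∑ (upTo (suc b)) (λ k → pos (suc a C k) ℤ.* h k) ℤ.+ pos (a C b) ℤ.* h (suc b)
        ≡⟨ pascal-sum a h b ⟩
      ∑ (upTo (suc b)) (λ k → pos (a C k) ℤ.* h k) ℤ.+ ∑ (upTo (suc b)) (λ k → pos (a C k) ℤ.* h (suc k))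
        ≡⟨ cong₂ ℤ._+_ (S-suc m g) (S-suc m (λ ν → g (Vec.updateAt ν zero suc))) ⟨
      S m g ℤ.+ S m (λ ν → g (Vec.updateAt ν zero suc)) ∎
      where
      a = m zero
      h : ℕ → ℤ
      h k = S (m ∘ suc) (λ ν → g (k ∷ ν))
    S-increment (suc x) m m′ e e′ g g0 = begin
      S m′ g
        ≡⟨ S-suc m′ g ⟩
      ∑ (upTo (suc b)) (λ k → pos (m′ zero C k) ℤ.* S (m′ ∘ suc) (λ ν → g (k ∷ ν)))
        ≡⟨ ∑-cong (upTo (suc b)) (λ k → trans
             (cong₂ (λ a z → pos (a C k) ℤ.* z) (e′ zero λ ())
               (S-increment x (m ∘ suc) (m′ ∘ suc) e (λ β β≢x → e′ (suc β) (β≢x ∘ Finₚ.suc-injective)) (λ ν → g (k ∷ ν)) (λ ν → g0 (k ∷ ν))))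
             (ℤₚ.*-distribˡ-+ (pos (m zero C k)) (h k) (h′ k))) ⟩
      ∑ (upTo (suc b)) (λ k → pos (m zero C k) ℤ.* h k ℤ.+ pos (m zero C k) ℤ.* h′ k)
        ≡⟨ ∑-+ (upTo (suc b)) (λ k → pos (m zero C k) ℤ.* h k) (λ k → pos (m zero C k) ℤ.* h′ k) ⟩
      ∑ (upTo (suc b)) (λ k → pos (m zero C k) ℤ.* h k) ℤ.+ ∑ (upTo (suc b)) (λ k → pos (m zero C k) ℤ.* h′ k)
        ≡⟨ cong₂ ℤ._+_ (S-suc m g) (S-suc m (λ ν → g (Vec.updateAt ν (suc x) suc))) ⟨
      S m g ℤ.+ S m (λ ν → g (Vec.updateAt ν (suc x) suc)) ∎
      where
      h h′ : ℕ → ℤ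
      h  k = S (m ∘ suc) (λ ν → g (k ∷ ν))
      h′ k = S (m ∘ suc) (λ ν → g (k ∷ Vec.updateAt ν x suc))

  total : ∀ {n} → Vec ℕ n → ℕ
  total ν = sumN (Vec.toList ν)

  -- Removing the first class shifts the labels of the others, so weights are a parameter; `id`
  -- gives back the sum of ν_β β.
  weighted : ∀ {n} → (Fin n → Elt) → Vec ℕ n → Elt
  weighted w ν = sumF (List.tabulate (λ β → smul (lookup ν β) (w β)))

  total-zero : ∀ n → total (replicate n 0) ≡ 0
  total-zero zero    = refl
  total-zero (suc n) = total-zero n

  weighted-zero : ∀ n (w : Fin n → Elt) → weighted w (replicate n 0) ≡ 0#
  weighted-zero zero    w = refl
  weighted-zero (suc n) w = trans (+-identityˡ _) (weighted-zero n (w ∘ suc))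

  total-increment : ∀ {n} (ν : Vec ℕ n) x → total (Vec.updateAt ν x suc) ≡ suc (total ν)
  total-increment (k ∷ ν) zero    = refl
  total-increment (k ∷ ν) (suc x) = trans (cong (k ℕ.+_) (total-increment ν x)) (ℕₚ.+-suc k _)

  weighted-increment : ∀ {n} w (ν : Vec ℕ n) x → weighted w (Vec.updateAt ν x suc) ≡ w x + weighted w ν
  weighted-increment w (k ∷ ν) zero    = +-assoc (w zero) _ _
  weighted-increment w (k ∷ ν) (suc x) = begin
    smul k (w zero) + weighted (w ∘ suc) (Vec.updateAt ν x suc)  ≡⟨ cong (smul k (w zero) +_) (weighted-increment (w ∘ suc) ν x) ⟩
    smul k (w zero) + (w (suc x) + W)                            ≡⟨ +-assoc _ _ W ⟨
    (smul k (w zero) + w (suc x)) + W                            ≡⟨ cong (_+ W) (+-comm _ _) ⟩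
    (w (suc x) + smul k (w zero)) + W                            ≡⟨ +-assoc _ _ W ⟩
    w (suc x) + (smul k (w zero) + W)                            ∎
    where W = weighted (w ∘ suc) ν

  lookup≤total : ∀ {n} (ν : Vec ℕ n) x → lookup ν x ≤ total ν
  lookup≤total (k ∷ ν) zero    = ℕₚ.m≤m+n k (total ν)
  lookup≤total (k ∷ ν) (suc x) = ℕₚ.≤-trans (lookup≤total ν x) (ℕₚ.m≤n+m (total ν) k)

  multiplicity : List Elt → Elt → ℕ
  multiplicity v β = length (filter (_≟F β) v)

  multiplicity-here : ∀ x v → multiplicity (x ∷ v) x ≡ suc (multiplicity v x)
  multiplicity-here x v = cong length (Listₚ.filter-accept (_≟F x) refl)

  multiplicity-there : ∀ x v β → β ≢ x → multiplicity (x ∷ v) β ≡ multiplicity v β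
  multiplicity-there x v β β≢x = cong length (Listₚ.filter-reject (_≟F β) (β≢x ∘ sym))

  bits : List Bool
  bits = true ∷ false ∷ []

  -- Both sides are linear in the test function k, and for each of them prepending
  -- x to v adds the term with k replaced by (a , t) ↦ k (1 + a) (x + t).
  wordSum : ∀ b (v : List Elt) (k : ℕ → Elt → ℤ) → (∀ a t → b < a → k a t ≡ pos 0) →
            ∑ (allVecs bits (length v)) (λ u → k (weight (Vec.toList u)) (dot (Vec.toList u) v)) ≡
            S b (multiplicity v) (λ ν → k (total ν) (weighted id ν))
  wordSum b []      k k0 = begin
    k 0 0# ℤ.+ pos 0                                          ≡⟨ ℤₚ.+-identityʳ _ ⟩
    k 0 0#                                                    ≡⟨ cong₂ k (total-zero q) (weighted-zero q id) ⟨
    k (total (replicate q 0)) (weighted id (replicate q 0))   ≡⟨ S-zero b (λ ν → k (total ν) (weighted id ν)) ⟨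
    S b (λ _ → 0) (λ ν → k (total ν) (weighted id ν))         ∎
  wordSum b (x ∷ v) k k0 = begin
    ∑ (allVecs bits (suc (length v))) (λ u → k (weight (Vec.toList u)) (dot (Vec.toList u) (x ∷ v)))
      ≡⟨ ∑-allVecs bits (length v) _ ⟩
    L′ ℤ.+ (L ℤ.+ pos 0)
      ≡⟨ trans (ℤ+-congˡ L′ (ℤₚ.+-identityʳ L)) (ℤₚ.+-comm L′ L) ⟩
    L ℤ.+ L′
      ≡⟨ cong₂ ℤ._+_ (wordSum b v k k0) (wordSum b v (λ a t → k (suc a) (x + t)) (λ a t b<a → k0 (suc a) (x + t) (ℕₚ.m<n⇒m<1+n b<a))) ⟩
    S b m g ℤ.+ S b m (λ ν → k (suc (total ν)) (x + weighted id ν))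
      ≡⟨ ℤ+-congˡ (S b m g) (S-cong b (λ β → refl) (λ ν → cong₂ k (total-increment ν x) (weighted-increment id ν x))) ⟨
    S b m g ℤ.+ S b m (λ ν → g (Vec.updateAt ν x suc))
      -- More than `b` choices in class `x` push the total above `b`, where `k` vanishes.
      ≡⟨ S-increment b x m (multiplicity (x ∷ v)) (multiplicity-here x v) (multiplicity-there x v) g
           (λ ν b<ν → k0 _ _ (ℕₚ.<-≤-trans b<ν (lookup≤total ν x))) ⟨
    S b (multiplicity (x ∷ v)) g ∎
    where
    m = multiplicity v
    g : Vec ℕ q → ℤ
    g ν = k (total ν) (weighted id ν)
    L L′ : ℤ
    L  = ∑ (allVecs bits (length v)) (λ u → k (weight (Vec.toList u)) (dot (Vec.toList u) v))
    L′ = ∑ (allVecs bits (length v)) (λ u → k (suc (weight (Vec.toList u))) (x + dot (Vec.toList u) v))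

  -- The test function is the indicator of weight `i` and dot product 0. It vanishes above weight
  -- `i`, so the cutoff b = i used by `families` is admissible.
  codeWeight-families : ∀ n i → pos (codeWeight n i) ≡
    ∑ (families i) (λ ν → List.foldr ℤ._*_ (pos 1) (List.map (λ β → binomℤ (pos (multiplicity (traceVec n) β)) (lookup ν β)) elements))
  codeWeight-families n i = begin
    pos (codeWeight n i)
      ≡⟨ length-filter-∑ (λ u → weight (Vec.toList u) ℕ.≟ i) (filter (λ u → dot (Vec.toList u) v ≟F 0#) (allVecs bits (length (SL n)))) ⟩
    ∑ (filter (λ u → dot (Vec.toList u) v ≟F 0#) (allVecs bits (length (SL n)))) (λ u → 𝟙 (weight (Vec.toList u) ℕ.≟ i))
      ≡⟨ ∑-filter (λ u → dot (Vec.toList u) v ≟F 0#) (allVecs bits (length (SL n))) (λ u → 𝟙 (weight (Vec.toList u) ℕ.≟ i)) ⟩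
    -- Words are indexed by the length of `SL n`, `wordSum` by that of the trace list. Abstracting
    -- the length in `words` lets it be rewritten without transporting vectors.
    words (length (SL n))
      ≡⟨ cong words (Listₚ.length-map (matTrace n) (SL n)) ⟨
    words (length v)
      ≡⟨ wordSum i v k k0 ⟩
    ∑ Ν (λ ν → binomials m ν ℤ.* k (total ν) (weighted id ν))
      ≡⟨ ∑-cong Ν (λ ν → trans (lem (binomials m ν) (𝟙 (weighted id ν ≟F 0#)) (𝟙 (total ν ℕ.≟ i)))
           (cong₂ (λ w p → 𝟙 (total ν ℕ.≟ i) ℤ.* (𝟙 (w ≟F 0#) ℤ.* p))
             (cong sumF (sym (Listₚ.map-tabulate id (λ β → smul (lookup ν β) β))))
             (cong (List.foldr ℤ._*_ (pos 1)) (sym (Listₚ.map-tabulate id (λ β → pos (m β C lookup ν β))))))) ⟩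
    ∑ Ν (λ ν → 𝟙 (total ν ℕ.≟ i) ℤ.* (𝟙 (constraint ν ≟F 0#) ℤ.* term ν))
      ≡⟨ ∑-filter (λ ν → total ν ℕ.≟ i) Ν (λ ν → 𝟙 (constraint ν ≟F 0#) ℤ.* term ν) ⟨
    ∑ (filter (λ ν → total ν ℕ.≟ i) Ν) (λ ν → 𝟙 (constraint ν ≟F 0#) ℤ.* term ν)
      ≡⟨ ∑-filter (λ ν → constraint ν ≟F 0#) (filter (λ ν → total ν ℕ.≟ i) Ν) term ⟨
    ∑ (families i) term ∎
    where
    v = traceVec n
    m = multiplicity v
    Ν = allVecs (upTo (suc i)) q
    k : ℕ → Elt → ℤ
    k a t = 𝟙 (t ≟F 0#) ℤ.* 𝟙 (a ℕ.≟ i)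
    k0 : ∀ a t → i < a → k a t ≡ pos 0
    k0 a t i<a = trans (ℤ*-congˡ (𝟙 (t ≟F 0#)) (𝟙-no (a ℕ.≟ i) (ℕₚ.>⇒≢ i<a))) (ℤₚ.*-zeroʳ (𝟙 (t ≟F 0#)))
    words : ℕ → ℤ
    words l = ∑ (allVecs bits l) (λ u → k (weight (Vec.toList u)) (dot (Vec.toList u) v))
    constraint : Vec ℕ q → Elt
    constraint ν = sumF (List.map (λ β → smul (lookup ν β) β) elements)
    term : Vec ℕ q → ℤ
    term ν = List.foldr ℤ._*_ (pos 1) (List.map (λ β → binomℤ (pos (m β)) (lookup ν β)) elements)
    lem : ∀ a b c → a ℤ.* (b ℤ.* c) ≡ c ℤ.* (b ℤ.* a)
    lem = ℤSolver.solve-∀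

-- `q` and `n` are variables tied to 2^r and 2^s by equations, so that `n` can be matched as
-- `suc (suc n′)` while the powers stay folded. The multiplicity of β in the trace list is the
-- number of determinant-1 matrices of trace β, that is, n_β.
codeWeight-rhs : ∀ s r → 0 < s → 0 < r → ∀ {q} → q ≡ 2 ^ r → (F : FiniteField q) → ∀ n i → 2 ^ s ≡ n → 2 ≤ n →
                 pos (FieldDefs.codeWeight F n i) ≡ FieldDefs.rhs F r n i
codeWeight-rhs s r 0<s 0<r q≡2^r F (suc zero)      i 2^s≡n (s≤s ())
codeWeight-rhs s r 0<s 0<r q≡2^r F n@(suc (suc n′)) i 2^s≡n _ = trans (codeWeight-families n i)
  (∑-cong (families i) (λ ν → cong (List.foldr ℤ._*_ (pos 1)) (Listₚ.map-cong (λ β → cong (λ z → binomℤ z (lookup ν β))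
    (trans (traceCount-length 0<r n β) (traceCount-formula 0<r s n′ 0<s 2^s≡n β))) elements)))
  where
  open FieldDefs F
  open WeightEnumerator F
  open Counting r q≡2^r F

open import Data.Integer using (+_)

theorem16 : (s r : ℕ) → 0 < s → 0 < r → (F : FiniteField (2 ^ r))
    → (i : ℕ) → i ≤ length (FieldDefs.SL F (2 ^ s))
    → + (FieldDefs.codeWeight F (2 ^ s) i) ≡ FieldDefs.rhs F r (2 ^ s) i
theorem16 s r 0<s 0<r F i _ = codeWeight-rhs s r 0<s 0<r refl F (2 ^ s) i refl (ℕₚ.^-monoʳ-≤ 2 0<s)
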